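{- Let $q$ be a prime power and for $n\ge1$ let $\rho_q(n)=\frac{\varphi(q^n-1)}{q^n}$ be the density of primitive elements in $\mathbb{F}_{q^n}$. For each positive integer $t$, let $L_t$ be the least common multiple of the positive integers $i\le t$, and set $A_t=\frac{1}{L_t}\sum_{r\mid L_t}\rho_q(r)\varphi\!\left(\frac{L_t}{r}\right)$. Then $\{A_t\}_{t\ge1}$ converges to a limit $\overline{\rho}_q>0$, and $$\overline{\rho}_q=\lim_{x\to+\infty}\frac{1}{x}\sum_{n\le x}\rho_q(n).$$ Moreover, $\liminf_{q\to+\infty}\overline{\rho}_q=0$ (the liminf over prime powers $q$).
   Context: $\varphi$ is Euler's totient function. $\mathbb{F}_{q^n}$ is the degree-$n$ extension of the finite field $\mathbb{F}_q$; a primitive element is a generator of the cyclic group $\mathbb{F}_{q^n}^*$, and there are $\varphi(q^n-1)$ of them. -}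

module Defs where

open import Data.Nat as ℕ using (ℕ; zero; suc; _^_; _∸_; _≤_; _≥_; _≟_)
open import Data.Nat.GCD using (gcd)
open import Data.Nat.LCM using (lcm)
open import Data.Nat.Divisibility using (_∣?_)
open import Data.Nat.Primality using (Prime)
open import Data.List using (List; filter; map; sum; upTo)
open import Data.Product using (Σ; _×_)
open import Data.Integer using (+_)
open import Data.Rational using (ℚ; 0ℚ; _+_; _*_; _-_; _<_; _≤_; ∣_∣)
import Data.Rational as Q
open import Relation.Binary.PropositionalEquality using (_≡_)

range1 : ℕ → List ℕ
range1 n = map suc (upTo n)

φ : ℕ → ℕ
φ n = Data.List.length (filter (λ k → gcd k n ≟ 1) (range1 n))

IsPrimePower : ℕ → Set
IsPrimePower q = Σ ℕ λ p → Σ ℕ λ k → Prime p × (1 ℕ.≤ k) × (q ≡ p ^ k)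

-- a / b as a rational number (b = 0 never occurs in our uses; then 0)
frac : ℕ → ℕ → ℚ
frac a zero = 0ℚ
frac a (suc d) = (+ a) Q./ suc d

-- natural-number quotient a / b (b = 0 never occurs in our uses; then 0)
quot : ℕ → ℕ → ℕ
quot a zero = 0
quot a (suc d) = a ℕ./ suc d

ρ : ℕ → ℕ → ℚ
ρ q n = frac (φ (q ^ n ∸ 1)) (q ^ n)

sumℚ : List ℚ → ℚ
sumℚ = Data.List.foldr _+_ 0ℚ

L : ℕ → ℕ
L t = Data.List.foldr lcm 1 (range1 t)

divisors : ℕ → List ℕ
divisors n = filter (λ r → r ∣? n) (range1 n)

A : ℕ → ℕ → ℚ
A q t = frac 1 (L t) * sumℚ (map (λ r → ρ q r * frac (φ (quot (L t) r)) 1) (divisors (L t)))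

M : ℕ → ℕ → ℚ
M q N = frac 1 N * sumℚ (map (ρ q) (range1 N))

Cauchy : (ℕ → ℚ) → Set
Cauchy a = ∀ (ε : ℚ) → 0ℚ < ε → Σ ℕ λ N → ∀ m n → N ℕ.≤ m → N ℕ.≤ n → ∣ a m - a n ∣ < ε

TendsToZero : (ℕ → ℚ) → Set
TendsToZero a = ∀ (ε : ℚ) → 0ℚ < ε → Σ ℕ λ N → ∀ n → N ℕ.≤ n → ∣ a n ∣ < ε

{-# OPTIONS --safe #-}
-- A_t is the average of ρ_q(gcd(n, L_t)) over n ≤ L_t, to be compared with averages of ρ_q(n), or of ρ_q(gcd(n, L_s))
-- with s ≥ t.  Write h(n) = φ(q^n - 1)/(q^n - 1).  For r | n a sieve gives h(n) ≤ h(r) and h(n) ≥ h(r)(1 - R), where R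
-- is the sum of 1/ℓ over the primes ℓ dividing q^n - 1 but not q^r - 1.  If r = gcd(n, L_t), then q has order k > t
-- modulo such an ℓ, with k | n and k | ℓ - 1; since the primes with order k are congruent to 1 modulo k and have product
-- below q^k, their reciprocals add up to at most (q + H_k)/k.  Hence R averages to at most the sum of (q + H_k)/k² over
-- k > t, which telescopes to O((q + H_t)/t).  The difference between ρ_q and h contributes the average of
-- q^(-gcd(n, L_t)), at most φ(L_t)/L_t ≤ 1/H_t.  For the last claim, take q ≡ 1 modulo K = L_s: then h(n) ≤ φ(K)/K.
module Submission where

open import Defs
open import Data.Nat using (ℕ; zero; suc; _≤_; z≤n; s≤s; _^_; _∸_; NonZero)

-- Number theory of q ^ n ∸ 1

-- The two comparisons have errors of different origin. Upwards, h can only fall from r to its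
-- multiple n, so the whole loss is the change of denominator from `q ^ r ∸ 1` to `q ^ r`.
-- Downwards, the change of denominator helps, and the whole loss is R. Positivity does not follow
-- from the lower comparison with its absolute error, because nothing yet keeps the average above
-- that error. But the loss in the sieve is a factor 1 - R, so it can be applied to a constant c =
-- q^(-L_t), which lies below ρ_q(r) for every r dividing L_t: once R averages to at most 1/2, half
-- of c survives at all later stages. All errors depend on t alone, and t is fixed before s or N.
-- The harmonic series enters from both sides: its divergence makes φ(L_t)/L_t small, its slow
-- growth makes the sieve error small.

module Arithmetic where

  open import Data.Nat
  open import Data.Nat.Properties
  open import Data.Nat.Divisibility
  open import Data.Nat.DivMod using (m/n*n≡m; m≡m%n+[m/n]*n; m%n<n)
  open import Data.Nat.GCD using (gcd; gcd-comm; gcd-GCD; gcd[m,n]∣m; gcd[m,n]∣n; gcd-greatest; gcd[m,n]≢0; module Bézout)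
  open import Data.Nat.LCM using (lcm; m∣lcm[m,n]; n∣lcm[m,n]; lcm-least)
  open import Data.Nat.Coprimality using (gcd≡1⇒coprime; coprime-divisor)
  open import Data.Nat.Combinatorics using (_C_; nCn≡1; nCk≡n!/k![n-k]!; k![n∸k]!∣n!)
  open import Data.Nat.Primality
  open import Data.Nat.Primality.Factorisation using (factorise)
  open import Data.Fin using (zero; suc; toℕ; fromℕ; fromℕ<; inject₁)
  open import Data.Fin.Properties using (pigeonhole; toℕ-fromℕ; toℕ-inject₁; toℕ-fromℕ<; toℕ<n)
  open import Data.List using ([]; _∷_; upTo; foldr)
  open import Data.List.Relation.Unary.All using ([]; _∷_)
  open import Data.List.Relation.Unary.Any using (here; there)
  open import Data.List.Membership.Propositional using (_∈_)
  open import Data.List.Membership.Propositional.Properties using (∈-map⁺; ∈-map⁻; ∈-upTo⁺; ∈-upTo⁻)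
  open import Data.Product using (Σ; _×_; _,_)
  open import Data.Sum using (_⊎_; inj₁; inj₂)
  open import Data.Empty using (⊥; ⊥-elim)
  open import Relation.Nullary using (¬_; yes; no)
  open import Relation.Binary.PropositionalEquality

  prime≥2 : ∀ {p} → Prime p → 2 ≤ p
  prime≥2 pp = nonTrivial⇒n>1 _ {{prime⇒nonTrivial pp}}

  ∃-prime-factor : ∀ {n} → 1 ≤ n → n ≢ 1 → Σ ℕ λ p → Prime p × p ∣ n
  ∃-prime-factor {n} 1≤n n≢1 with factorise n {{>-nonZero 1≤n}}
  ... | record { factors = [] ; isFactorisation = eq } = ⊥-elim (n≢1 eq)
  ... | record { factors = p ∷ ps ; isFactorisation = eq ; factorsPrime = pp ∷ _ } = p , pp , subst (p ∣_) (sym eq) (m∣m*n _)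

  1≤*⇒1≤ : ∀ m n → 1 ≤ m * n → 1 ≤ m × 1 ≤ n
  1≤*⇒1≤ (suc m) (suc n) _ = s≤s z≤n , s≤s z≤n
  1≤*⇒1≤ (suc m) zero h = ⊥-elim (n>0⇒n≢0 h (*-zeroʳ m))

  prime∣prime⇒≡ : ∀ {p ℓ} → Prime p → Prime ℓ → p ∣ ℓ → p ≡ ℓ
  prime∣prime⇒≡ pp pℓ p∣ℓ with prime⇒irreducible pℓ p∣ℓ
  ... | inj₁ refl = ⊥-elim (¬prime[1] pp)
  ... | inj₂ eq = eq

  gcd≥1ʳ : ∀ a {b} → 1 ≤ b → 1 ≤ gcd a b
  gcd≥1ʳ a {b} 1≤b = n≢0⇒n>0 (gcd[m,n]≢0 a b (inj₂ (n>0⇒n≢0 1≤b)))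

  no-common-prime⇒gcd≡1 : ∀ a {b} → 1 ≤ b → (∀ {p} → Prime p → p ∣ a → p ∣ b → ⊥) → gcd a b ≡ 1
  no-common-prime⇒gcd≡1 a {b} 1≤b h with gcd a b ≟ 1
  ... | yes eq = eq
  ... | no neq with ∃-prime-factor (gcd≥1ʳ a 1≤b) neq
  ... | p , pp , p∣g = ⊥-elim (h pp (∣-trans p∣g (gcd[m,n]∣m a b)) (∣-trans p∣g (gcd[m,n]∣n a b)))

  gcd≡1-∣ : ∀ {a a′ b b′} → a′ ∣ a → b′ ∣ b → gcd a b ≡ 1 → gcd a′ b′ ≡ 1
  gcd≡1-∣ {a} {a′} {b} {b′} a′∣a b′∣b eq =
    ∣1⇒≡1 (subst (gcd a′ b′ ∣_) eq (gcd-greatest (∣-trans (gcd[m,n]∣m a′ b′) a′∣a) (∣-trans (gcd[m,n]∣n a′ b′) b′∣b)))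

  gcd≡1⇒∤prime : ∀ {a b p} → gcd a b ≡ 1 → Prime p → p ∣ a → p ∣ b → ⊥
  gcd≡1⇒∤prime {p = p} eq pp p∣a p∣b = ¬prime[1] (subst Prime (∣1⇒≡1 (subst (p ∣_) eq (gcd-greatest p∣a p∣b))) pp)

  gcd-periodic : ∀ K i → gcd (K + i) K ≡ gcd i K
  gcd-periodic K i = ∣-antisym
    (gcd-greatest (∣m+n∣m⇒∣n (gcd[m,n]∣m (K + i) K) (gcd[m,n]∣n (K + i) K)) (gcd[m,n]∣n (K + i) K))
    (gcd-greatest (∣m∣n⇒∣m+n (gcd[m,n]∣n i K) (gcd[m,n]∣m i K)) (gcd[m,n]∣n i K))

  gcd-absorb-prime : ∀ v {ℓ d} → Prime ℓ → 1 ≤ d → ¬ ℓ ∣ d → gcd v d ≡ 1 → gcd (v * ℓ) d ≡ 1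
  gcd-absorb-prime v {ℓ} {d} pℓ 1≤d ℓ∤d eq = no-common-prime⇒gcd≡1 (v * ℓ) 1≤d λ {p} pp p∣vℓ p∣d → case pp p∣d (euclidsLemma v ℓ pp p∣vℓ)
    where
    case : ∀ {p} → Prime p → p ∣ d → p ∣ v ⊎ p ∣ ℓ → ⊥
    case pp p∣d (inj₁ p∣v) = gcd≡1⇒∤prime eq pp p∣v p∣d
    case pp p∣d (inj₂ p∣ℓ) = ℓ∤d (subst (_∣ d) (prime∣prime⇒≡ pp pℓ p∣ℓ) p∣d)

  module _ {x : ℕ} (1≤x : 1 ≤ x) where

    1≤^ : ∀ n → 1 ≤ x ^ n
    1≤^ n = m^n>0 x {{>-nonZero 1≤x}} n

    ^≡1+ : ∀ n → x ^ n ≡ 1 + (x ^ n ∸ 1)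
    ^≡1+ n = sym (m+[n∸m]≡n (1≤^ n))

    -- Modulo `d`, this makes the exponents n with `d ∣ x ^ n ∸ 1` closed under addition and under
    -- cancelling a summand.
    ^∸1-+ : ∀ m n → x ^ (m + n) ∸ 1 ≡ x ^ m * (x ^ n ∸ 1) + (x ^ m ∸ 1)
    ^∸1-+ m n = begin
      x ^ (m + n) ∸ 1                        ≡⟨ cong (_∸ 1) (^-distribˡ-+-* x m n) ⟩
      x ^ m * x ^ n ∸ 1                      ≡⟨ cong (λ y → x ^ m * y ∸ 1) (^≡1+ n) ⟩
      x ^ m * (1 + (x ^ n ∸ 1)) ∸ 1          ≡⟨ cong (_∸ 1) (*-distribˡ-+ (x ^ m) 1 (x ^ n ∸ 1)) ⟩
      x ^ m * 1 + x ^ m * (x ^ n ∸ 1) ∸ 1    ≡⟨ cong (_∸ 1) (trans (cong (_+ x ^ m * (x ^ n ∸ 1)) (*-identityʳ (x ^ m))) (+-comm (x ^ m) _)) ⟩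
      x ^ m * (x ^ n ∸ 1) + x ^ m ∸ 1        ≡⟨ +-∸-assoc (x ^ m * (x ^ n ∸ 1)) (1≤^ m) ⟩
      x ^ m * (x ^ n ∸ 1) + (x ^ m ∸ 1)      ∎
      where open ≡-Reasoning

    ∣^∸1-* : ∀ {d} k n → d ∣ x ^ k ∸ 1 → d ∣ x ^ (n * k) ∸ 1
    ∣^∸1-* {d} k zero h = d ∣0
    ∣^∸1-* {d} k (suc n) h = subst (d ∣_) (sym (^∸1-+ k (n * k))) (∣m∣n⇒∣m+n (∣n⇒∣m*n (x ^ k) (∣^∸1-* k n h)) h)

    ∣^∸1-mono : ∀ {d k n} → k ∣ n → d ∣ x ^ k ∸ 1 → d ∣ x ^ n ∸ 1
    ∣^∸1-mono {d} {k} (divides n refl) h = ∣^∸1-* k n h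

    -- Bézout over ℕ expresses `gcd m n` plus a multiple of one exponent as a multiple of the other;
    -- cancelling that summand leaves the gcd.
    ∣^∸1-gcd : ∀ {d} m n → d ∣ x ^ m ∸ 1 → d ∣ x ^ n ∸ 1 → d ∣ x ^ gcd m n ∸ 1
    ∣^∸1-gcd {d} m n hm hn with Bézout.identity (gcd-GCD m n)
    ... | Bézout.+- a b eq = ∣m+n∣m⇒∣n
      (subst (d ∣_) (^∸1-+ (gcd m n) (b * n)) (subst (λ z → d ∣ x ^ z ∸ 1) (sym eq) (∣^∸1-* m a hm)))
      (∣n⇒∣m*n (x ^ gcd m n) (∣^∸1-* n b hn))
    ... | Bézout.-+ a b eq = ∣m+n∣m⇒∣n
      (subst (d ∣_) (^∸1-+ (gcd m n) (a * m)) (subst (λ z → d ∣ x ^ z ∸ 1) (sym eq) (∣^∸1-* n b hn)))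
      (∣n⇒∣m*n (x ^ gcd m n) (∣^∸1-* m a hm))

  -- Fermat's little theorem

  prime∤! : ∀ {p} m → Prime p → m < p → ¬ p ∣ m !
  prime∤! zero pp m<p p∣ = ¬prime[1] (subst Prime (∣1⇒≡1 p∣) pp)
  prime∤! (suc m) pp m<p p∣ with euclidsLemma (suc m) (m !) pp p∣
  ... | inj₁ h = <⇒≱ m<p (∣⇒≤ h)
  ... | inj₂ h = prime∤! m pp (<-trans (n<1+n m) m<p) h

  -- `p` divides `p !`, which is the binomial coefficient times `k !` and `(p ∸ k) !`, and these
  -- factorials have only factors below `p`.
  prime∣C : ∀ {p k} → Prime p → 1 ≤ k → k < p → p ∣ p C k
  prime∣C {p@(suc p-1)} {k} pp 1≤k k<p with euclidsLemma (p C k) (k ! * (p ∸ k) !) pp (subst (p ∣_) (sym eq) (m∣m*n (p-1 !)))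
    where
    instance
      d≢0 : NonZero (k ! * (p ∸ k) !)
      d≢0 = k !* (p ∸ k) !≢0
    eq : (p C k) * (k ! * (p ∸ k) !) ≡ p !
    eq = trans (cong (_* (k ! * (p ∸ k) !)) (nCk≡n!/k![n-k]! (<⇒≤ k<p))) (m/n*n≡m (k![n∸k]!∣n! (<⇒≤ k<p)))
  ... | inj₁ h = h
  ... | inj₂ h with euclidsLemma (k !) ((p ∸ k) !) pp h
  ... | inj₁ h′ = ⊥-elim (prime∤! k pp k<p h′)
  ... | inj₂ h′ = ⊥-elim (prime∤! (p ∸ k) pp (∸-monoʳ-< 1≤k (<⇒≤ k<p)) h′)

  module _ where
    open import Algebra.Properties.CommutativeSemiring.Binomial +-*-commutativeSemiring using (theorem; binomialTerm)
    open import Algebra.Properties.Semiring.Sum +-*-semiring using (sum; sum-init-last)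
    open import Algebra.Properties.Semiring.Exp +-*-semiring using () renaming (_^_ to _^′_)
    open import Algebra.Properties.Semiring.Mult +-*-semiring using () renaming (_×_ to _×′_)
    open import Data.Vec.Functional using (Vector; tail; init; last)

    private
      ^′≡^ : ∀ x n → x ^′ n ≡ x ^ n
      ^′≡^ x zero = refl
      ^′≡^ x (suc n) = cong (x *_) (^′≡^ x n)

      ×′≡* : ∀ n x → n ×′ x ≡ n * x
      ×′≡* zero x = refl
      ×′≡* (suc n) x = cong (x +_) (×′≡* n x)

      ∣sum : ∀ {d n} (t : Vector ℕ n) → (∀ i → d ∣ t i) → d ∣ sum t
      ∣sum {d} {zero} t h = d ∣0
      ∣sum {d} {suc n} t h = ∣m∣n⇒∣m+n (h zero) (∣sum (λ i → t (suc i)) λ i → h (suc i))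

    -- The outer terms of the binomial expansion are 1 and `a ^ p`, and `p` divides all the others.
    -- The explicit quotient `e` replaces a congruence.
    binomial-prime : ∀ {p} a → Prime p → Σ ℕ λ e → (1 + a) ^ p ≡ 1 + a ^ p + e * p
    binomial-prime {zero} a pp = ⊥-elim (¬prime[0] pp)
    binomial-prime {p@(suc n)} a pp with ∣sum {p} (init (tail t)) mid
      where
      t : Vector ℕ (suc p)
      t = binomialTerm a 1 p
      mid : ∀ i → p ∣ init (tail t) i
      mid i = subst (p ∣_) (sym (×′≡* (p C suc (toℕ (inject₁ i))) _))
        (∣m⇒∣m*n _ (prime∣C pp (s≤s z≤n) (s≤s (subst (_< n) (sym (toℕ-inject₁ i)) (toℕ<n i)))))
    ... | divides e eq = e , (begin
      (1 + a) ^ p                            ≡⟨ cong (_^ p) (+-comm 1 a) ⟩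
      (a + 1) ^ p                            ≡⟨ sym (^′≡^ (a + 1) p) ⟩
      (a + 1) ^′ p                           ≡⟨ theorem p a 1 ⟩
      t zero + sum (tail t)                  ≡⟨ cong₂ _+_ t₀ (sum-init-last (tail t)) ⟩
      1 + (sum (init (tail t)) + last (tail t)) ≡⟨ cong₂ (λ x y → 1 + (x + y)) eq tₚ ⟩
      1 + (e * p + a ^ p)                    ≡⟨ cong (1 +_) (+-comm (e * p) (a ^ p)) ⟩
      1 + a ^ p + e * p                      ∎)
      where
      open ≡-Reasoning
      t : Vector ℕ (suc p)
      t = binomialTerm a 1 p
      1^′ : ∀ m → 1 ^′ m ≡ 1
      1^′ m = trans (^′≡^ 1 m) (^-zeroˡ m)
      t₀ : t zero ≡ 1
      t₀ = trans (×′≡* (p C 0) (1 * (1 ^′ p))) (cong (λ z → (p C 0) * (1 * z)) (1^′ p))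
      tₚ : last (tail t) ≡ a ^ p
      tₚ = trans (×′≡* (p C toℕ (suc (fromℕ n))) _) (trans (cong₂ (λ k b → (p C k) * b) k≡p
        (cong₂ _*_ (trans (cong (a ^′_) k≡p) (^′≡^ a p)) (1^′ (p ∸ toℕ (suc (fromℕ n))))))
        (trans (cong (_* (a ^ p * 1)) (nCn≡1 p)) (trans (*-identityˡ _) (*-identityʳ (a ^ p)))))
        where
        k≡p : toℕ (suc (fromℕ n)) ≡ p
        k≡p = cong suc (toℕ-fromℕ n)

  fermat : ∀ {p} a → Prime p → Σ ℕ λ c → a ^ p ≡ a + c * p
  fermat {zero} a pp = ⊥-elim (¬prime[0] pp)
  fermat {suc p-1} zero pp = 0 , refl
  fermat {p} (suc a) pp with binomial-prime a pp | fermat a pp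
  ... | e , eq₁ | c , eq₂ = c + e , (begin
    (1 + a) ^ p               ≡⟨ eq₁ ⟩
    1 + a ^ p + e * p         ≡⟨ cong (λ x → 1 + x + e * p) eq₂ ⟩
    1 + (a + c * p) + e * p   ≡⟨ +-assoc (1 + a) (c * p) (e * p) ⟩
    1 + a + (c * p + e * p)   ≡⟨ cong (1 + a +_) (sym (*-distribʳ-+ p c e)) ⟩
    1 + a + (c + e) * p       ∎)
    where open ≡-Reasoning

  fermat-∣ : ∀ {p} a → Prime p → ¬ p ∣ a → p ∣ a ^ (p ∸ 1) ∸ 1
  fermat-∣ {zero} a pp _ = ⊥-elim (¬prime[0] pp)
  fermat-∣ {p@(suc p-1)} a pp p∤a with fermat a pp
  ... | c , eq with euclidsLemma a (a ^ p-1 ∸ 1) pp (divides c (begin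
    a * (a ^ p-1 ∸ 1)     ≡⟨ *-distribˡ-∸ a (a ^ p-1) 1 ⟩
    a ^ p ∸ a * 1         ≡⟨ cong (_∸ a * 1) eq ⟩
    a + c * p ∸ a * 1     ≡⟨ cong (a + c * p ∸_) (*-identityʳ a) ⟩
    a + c * p ∸ a         ≡⟨ m+n∸m≡n a (c * p) ⟩
    c * p                 ∎))
    where open ≡-Reasoning
  ... | inj₁ p∣a = ⊥-elim (p∤a p∣a)
  ... | inj₂ h = h

  -- k = gcd n (ℓ ∸ 1) is a multiple of the order of q modulo ℓ, and is as good as the order itself.
  order-witness : ∀ {q ℓ n r} → 1 ≤ q → 1 ≤ n → Prime ℓ → ℓ ∣ q ^ n ∸ 1 → ¬ ℓ ∣ q ^ r ∸ 1 →
    Σ ℕ λ k → 1 ≤ k × k ∣ n × k ∣ ℓ ∸ 1 × ℓ ∣ q ^ k ∸ 1 × ¬ k ∣ r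
  order-witness {q} {ℓ} {n@(suc n-1)} {r} 1≤q 1≤n pℓ h ¬h =
    k , subst (1 ≤_) (gcd-comm (ℓ ∸ 1) n) (gcd≥1ʳ (ℓ ∸ 1) 1≤n) , gcd[m,n]∣m n (ℓ ∸ 1) , gcd[m,n]∣n n (ℓ ∸ 1)
      , ℓ∣k , λ k∣r → ¬h (∣^∸1-mono 1≤q k∣r ℓ∣k)
    where
    k : ℕ
    k = gcd n (ℓ ∸ 1)
    -- A common factor `ℓ` of `q` and `q ^ n ∸ 1` would divide 1, as n is positive.
    ℓ∤q : ¬ ℓ ∣ q
    ℓ∤q ℓ∣q = ¬prime[1] (subst Prime (∣1⇒≡1 (∣m+n∣m⇒∣n
      (subst (ℓ ∣_) (trans (^≡1+ 1≤q n) (+-comm 1 _)) (∣m⇒∣m*n (q ^ n-1) ℓ∣q)) h)) pℓ)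
    ℓ∣k : ℓ ∣ q ^ k ∸ 1
    ℓ∣k = ∣^∸1-gcd 1≤q n (ℓ ∸ 1) h (fermat-∣ q pℓ ℓ∤q)

  -- The least common multiples `L t`

  module _ where
    private
      ∈⇒∣lcm : ∀ {j xs} → j ∈ xs → j ∣ foldr lcm 1 xs
      ∈⇒∣lcm {xs = x ∷ xs} (here refl) = m∣lcm[m,n] x _
      ∈⇒∣lcm {xs = x ∷ xs} (there h) = ∣-trans (∈⇒∣lcm h) (n∣lcm[m,n] x _)

      lcm-least* : ∀ {c} xs → (∀ {j} → j ∈ xs → j ∣ c) → foldr lcm 1 xs ∣ c
      lcm-least* {c} [] h = 1∣ c
      lcm-least* (x ∷ xs) h = lcm-least (h (here refl)) (lcm-least* xs λ j∈ → h (there j∈))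

    ≤⇒∣L : ∀ {j t} → 1 ≤ j → j ≤ t → j ∣ L t
    ≤⇒∣L {suc j} _ j≤t = ∈⇒∣lcm (∈-map⁺ suc (∈-upTo⁺ j≤t))

    L-least : ∀ {c t} → (∀ {j} → 1 ≤ j → j ≤ t → j ∣ c) → L t ∣ c
    L-least {c} {t} h = lcm-least* (range1 t) λ j∈ → lemma (∈-map⁻ suc j∈)
      where
      lemma : ∀ {j} → Σ ℕ (λ i → i ∈ upTo t × j ≡ suc i) → j ∣ c
      lemma (i , i∈ , refl) = h (s≤s z≤n) (∈-upTo⁻ i∈)

  L-∣ : ∀ {s t} → s ≤ t → L s ∣ L t
  L-∣ s≤t = L-least λ 1≤j j≤s → ≤⇒∣L 1≤j (≤-trans j≤s s≤t)

  1≤L : ∀ t → 1 ≤ L t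
  -- `L t` divides `t !`, and 0 divides no positive number.
  1≤L t = n≢0⇒n>0 λ L≡0 → n>0⇒n≢0 (1≤n! t) (0∣⇒≡0 (subst (_∣ t !) L≡0 (L-least {t = t} λ j≥1 j≤t → ∣! j≤t j≥1)))
    where
    ∣! : ∀ {j t} → j ≤ t → 1 ≤ j → j ∣ t !
    ∣! {suc j} {suc t} j≤t 1≤j with suc j ≟ suc t
    ... | yes refl = m∣m*n (t !)
    ... | no neq = ∣n⇒∣m*n (suc t) (∣! (≤-pred (≤∧≢⇒< j≤t neq)) 1≤j)

  -- Prime powers congruent to 1 modulo K

  n<2^n : ∀ n → n < 2 ^ n
  n<2^n zero = s≤s z≤n
  n<2^n (suc n) = subst (suc (suc n) ≤_) (cong (2 ^ n +_) (sym (+-identityʳ (2 ^ n)))) (+-mono-≤ (≤-trans (s≤s z≤n) (n<2^n n)) (n<2^n n))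

  -- Two of the powers of `p` with exponents 0 to `K` agree modulo `K`, and the smaller one can be
  -- cancelled since `p` is coprime to `K`.
  ∃-exponent : ∀ {p K} → 1 ≤ p → 1 ≤ K → gcd K p ≡ 1 → Σ ℕ λ e → 1 ≤ e × K ∣ p ^ e ∸ 1
  ∃-exponent {p} {K} 1≤p 1≤K cop with pigeonhole (n<1+n K) (λ i → fromℕ< (m%n<n (p ^ toℕ i) K {{>-nonZero 1≤K}}))
  ... | i , j , i<j , eq = b ∸ a , m<n⇒0<n∸m i<j , strip a (subst (K ∣_) expand K∣diff)
    where
    instance
      K≢0 : NonZero K
      K≢0 = >-nonZero 1≤K
    a b : ℕ
    a = toℕ i
    b = toℕ j
    %≡ : p ^ a % K ≡ p ^ b % K
    %≡ = trans (sym (toℕ-fromℕ< _)) (trans (cong toℕ eq) (toℕ-fromℕ< _))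
    K∣diff : K ∣ p ^ b ∸ p ^ a
    K∣diff = divides (p ^ b / K ∸ p ^ a / K) (trans
      (cong₂ _∸_ (trans (m≡m%n+[m/n]*n (p ^ b) K) (cong (_+ p ^ b / K * K) (sym %≡))) (m≡m%n+[m/n]*n (p ^ a) K))
      (trans ([m+n]∸[m+o]≡n∸o (p ^ a % K) _ _) (sym (*-distribʳ-∸ K (p ^ b / K) (p ^ a / K)))))
    expand : p ^ b ∸ p ^ a ≡ p ^ a * (p ^ (b ∸ a) ∸ 1)
    expand = trans (cong₂ _∸_ (trans (cong (p ^_) (sym (m+[n∸m]≡n (<⇒≤ i<j)))) (^-distribˡ-+-* p a (b ∸ a))) (sym (*-identityʳ (p ^ a))))
      (sym (*-distribˡ-∸ (p ^ a) (p ^ (b ∸ a)) 1))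
    strip : ∀ c {x} → K ∣ p ^ c * x → K ∣ x
    strip zero {x} h = subst (K ∣_) (*-identityˡ x) h
    strip (suc c) {x} h = strip c (coprime-divisor (gcd≡1⇒coprime cop) (subst (K ∣_) (*-assoc p (p ^ c) x) h))

  -- Instead of Dirichlet's theorem: a prime factor `p` of `suc K` is coprime to `K`, so some
  -- `p ^ e` is 1 modulo `K`. So are the powers of `p ^ e`, and the `suc N`-th is large enough.
  ∃-prime-power : ∀ {K} N → 1 ≤ K → Σ ℕ λ q → IsPrimePower q × N ≤ q × K ∣ q ∸ 1
  ∃-prime-power {K} N 1≤K with ∃-prime-factor {suc K} (s≤s z≤n) (λ eq → n>0⇒n≢0 1≤K (suc-injective eq))
  ... | p , pp , p∣1+K with ∃-exponent (≤-trans (s≤s z≤n) (prime≥2 pp)) 1≤K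
      (∣1⇒≡1 (∣m+n∣m⇒∣n (subst (gcd K p ∣_) (+-comm 1 K) (∣-trans (gcd[m,n]∣n K p) p∣1+K)) (gcd[m,n]∣m K p)))
  ... | e , 1≤e , h = p ^ (suc N * e) , (p , suc N * e , pp , *-mono-≤ (s≤s (z≤n {N})) 1≤e , refl)
      , big , ∣^∸1-* (≤-trans (s≤s z≤n) (prime≥2 pp)) e (suc N) h
    where
    big : N ≤ p ^ (suc N * e)
    big = begin
      N               ≤⟨ n≤1+n N ⟩
      suc N           ≤⟨ <⇒≤ (n<2^n (suc N)) ⟩
      2 ^ suc N       ≤⟨ ^-monoˡ-≤ (suc N) (prime≥2 pp) ⟩
      p ^ suc N       ≤⟨ ^-monoʳ-≤ p {{prime⇒nonZero pp}} (m≤m*n (suc N) e {{>-nonZero 1≤e}}) ⟩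
      p ^ (suc N * e) ∎
      where open ≤-Reasoning

  prime-power≥2 : ∀ {q} → IsPrimePower q → 2 ≤ q
  prime-power≥2 (p , k , pp , 1≤k , refl) = ≤-trans (prime≥2 pp)
    (subst (_≤ p ^ k) (^-identityʳ p) (^-monoʳ-≤ p {{prime⇒nonZero pp}} 1≤k))

  2^-cancel-< : ∀ {m n} → 2 ^ m < 2 ^ n → m < n
  2^-cancel-< {m} {n} h = ≰⇒> λ n≤m → <⇒≱ h (^-monoʳ-≤ 2 n≤m)

  -- Deliberately crude, with `q` in place of its logarithm: `q` is fixed while `k` grows. This is
  -- the origin of the term `ι q` in `weight`.
  ^≤2^* : ∀ q k → q ^ k ≤ 2 ^ (q * k)
  ^≤2^* q k = subst (q ^ k ≤_) (^-*-assoc 2 q k) (^-monoˡ-≤ k (<⇒≤ (n<2^n q)))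

open Arithmetic

import Data.Nat as ℕ
import Data.Nat.Properties as ℕP
open import Data.Nat.Divisibility
open import Data.Nat.DivMod using (m≡m%n+[m/n]*n; m%n<n; m*n/n≡m)
open import Data.Nat.GCD using (gcd; gcd-comm; gcd[m,n]∣m; gcd[m,n]∣n; gcd-greatest; c*gcd[m,n]≡gcd[cm,cn])
open import Data.Nat.Coprimality using (coprime-divisor; gcd≡1⇒coprime)
open import Data.Nat.Primality using (Prime; prime?; euclidsLemma; productOfPrimes≥1)
open import Data.Nat.Primality.Factorisation using (factorise; PrimeFactorisation)
open import Data.List.Relation.Unary.All using (All; []; _∷_)
open import Data.List using ([]; _∷_; _++_; filter; map; upTo)
import Data.List as List
open import Data.Nat.ListAction using (product)
import Data.List.Properties as ListP
import Data.Integer as ℤ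
import Data.Integer.Properties as ℤP
open import Data.Rational using (ℚ; 0ℚ; 1ℚ; _+_; _*_; _-_; -_; _<_)
import Data.Rational as Q
import Data.Rational.Properties as QP
import Data.Rational.Unnormalised as ℚᵘ
import Data.Rational.Unnormalised.Properties as ℚᵘP
open import Data.Rational.Solver using (module +-*-Solver)
open +-*-Solver using (solve; _:=_; _:+_; _:*_; _:-_; :-_; con)
open import Data.Bool using (if_then_else_)
open import Data.Empty using (⊥-elim)
open import Data.Product using (Σ; _×_; _,_; proj₁; proj₂)
open import Data.Sum using (_⊎_; inj₁; inj₂)
open import Relation.Binary.PropositionalEquality
open import Relation.Nullary using (¬_; Dec; yes; no; does)
open import Relation.Nullary.Decidable using (_×-dec_; ¬?)

-- Rational arithmetic

-- Opaque, so that later arguments rest on the laws below and never unfold the normalisation of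
-- fractions. The default `inv 0` is 0.
opaque
  ι : ℕ → ℚ
  ι n = frac n 1

  inv : ℕ → ℚ
  inv n = frac 1 n

  ι≃ : ∀ n → Q.toℚᵘ (ι n) ℚᵘ.≃ ℚᵘ.mkℚᵘ (ℤ.+ n) 0
  ι≃ n = QP.toℚᵘ-fromℚᵘ (ℚᵘ.mkℚᵘ (ℤ.+ n) 0)

  frac≃ : ∀ a d → Q.toℚᵘ (frac a (suc d)) ℚᵘ.≃ ℚᵘ.mkℚᵘ (ℤ.+ a) d
  frac≃ a d = QP.toℚᵘ-fromℚᵘ (ℚᵘ.mkℚᵘ (ℤ.+ a) d)

  ι-0 : ι 0 ≡ 0ℚ
  ι-0 = refl

  inv-0 : inv 0 ≡ 0ℚ
  inv-0 = refl

  ι-1 : ι 1 ≡ 1ℚ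
  ι-1 = refl

  ι-+ : ∀ m n → ι (m ℕ.+ n) ≡ ι m + ι n
  ι-+ m n = QP.toℚᵘ-injective (begin
    Q.toℚᵘ (ι (m ℕ.+ n))                ≈⟨ ι≃ (m ℕ.+ n) ⟩
    ℚᵘ.mkℚᵘ (ℤ.+ (m ℕ.+ n)) 0
      ≈⟨ ℚᵘ.*≡* (cong (ℤ._* (ℤ.+ 1)) (cong₂ ℤ._+_ (sym (ℤP.*-identityʳ (ℤ.+ m))) (sym (ℤP.*-identityʳ (ℤ.+ n))))) ⟩
    ℚᵘ.mkℚᵘ (ℤ.+ m) 0 ℚᵘ.+ ℚᵘ.mkℚᵘ (ℤ.+ n) 0 ≈⟨ ℚᵘP.+-cong (ι≃ m) (ι≃ n) ⟨
    Q.toℚᵘ (ι m) ℚᵘ.+ Q.toℚᵘ (ι n)      ≈⟨ QP.toℚᵘ-homo-+ (ι m) (ι n) ⟨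
    Q.toℚᵘ (ι m + ι n)                  ∎)
    where open ℚᵘP.≃-Reasoning

  ι-* : ∀ m n → ι (m ℕ.* n) ≡ ι m * ι n
  ι-* m n = QP.toℚᵘ-injective (begin
    Q.toℚᵘ (ι (m ℕ.* n))                ≈⟨ ι≃ (m ℕ.* n) ⟩
    ℚᵘ.mkℚᵘ (ℤ.+ (m ℕ.* n)) 0             ≈⟨ ℚᵘ.*≡* (cong (ℤ._* (ℤ.+ 1)) (ℤP.pos-* m n)) ⟩
    ℚᵘ.mkℚᵘ (ℤ.+ m) 0 ℚᵘ.* ℚᵘ.mkℚᵘ (ℤ.+ n) 0 ≈⟨ ℚᵘP.*-cong (ι≃ m) (ι≃ n) ⟨
    Q.toℚᵘ (ι m) ℚᵘ.* Q.toℚᵘ (ι n)      ≈⟨ QP.toℚᵘ-homo-* (ι m) (ι n) ⟨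
    Q.toℚᵘ (ι m * ι n)                  ∎)
    where open ℚᵘP.≃-Reasoning

  frac-def : ∀ a b → frac a b ≡ ι a * inv b
  frac-def a zero = sym (QP.*-zeroʳ (ι a))
  frac-def a (suc d) = QP.toℚᵘ-injective (begin
    Q.toℚᵘ (frac a (suc d))             ≈⟨ frac≃ a d ⟩
    ℚᵘ.mkℚᵘ (ℤ.+ a) d
      ≈⟨ ℚᵘ.*≡* (cong₂ ℤ._*_ (sym (ℤP.*-identityʳ (ℤ.+ a))) (cong ℤ.+_ (ℕP.+-identityʳ (suc d)))) ⟩
    ℚᵘ.mkℚᵘ (ℤ.+ a) 0 ℚᵘ.* ℚᵘ.mkℚᵘ (ℤ.+ 1) d ≈⟨ ℚᵘP.*-cong (ι≃ a) (frac≃ 1 d) ⟨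
    Q.toℚᵘ (ι a) ℚᵘ.* Q.toℚᵘ (frac 1 (suc d)) ≈⟨ QP.toℚᵘ-homo-* (ι a) (frac 1 (suc d)) ⟨
    Q.toℚᵘ (ι a * frac 1 (suc d))       ∎)
    where open ℚᵘP.≃-Reasoning

  ι*inv : ∀ {n} → 1 ≤ n → ι n * inv n ≡ 1ℚ
  ι*inv {suc d} _ = trans (sym (frac-def (suc d) (suc d))) (QP.toℚᵘ-injective (begin
    Q.toℚᵘ (frac (suc d) (suc d)) ≈⟨ frac≃ (suc d) d ⟩
    ℚᵘ.mkℚᵘ (ℤ.+ suc d) d           ≈⟨ ℚᵘ.*≡* (ℤP.*-comm (ℤ.+ suc d) (ℤ.+ 1)) ⟩
    ℚᵘ.mkℚᵘ (ℤ.+ 1) 0               ∎))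
    where open ℚᵘP.≃-Reasoning

  0≤ι : ∀ n → 0ℚ Q.≤ ι n
  0≤ι n = QP.nonNegative⁻¹ (ι n) {{QP.normalize-nonNeg n 1}}

  0≤inv : ∀ n → 0ℚ Q.≤ inv n
  0≤inv zero = QP.≤-refl
  0≤inv (suc d) = QP.nonNegative⁻¹ (inv (suc d)) {{QP.normalize-nonNeg 1 (suc d)}}

  0<inv : ∀ {n} → 1 ≤ n → 0ℚ < inv n
  0<inv {suc d} _ = QP.positive⁻¹ (inv (suc d)) {{QP.normalize-pos 1 (suc d)}}

  frac1 : ∀ n → frac 1 n ≡ inv n
  frac1 n = refl

  frac/1 : ∀ n → frac n 1 ≡ ι n
  frac/1 n = refl

  archimedean : ∀ {ε} → 0ℚ < ε → Σ ℕ λ a → 1 ≤ a × inv a < ε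
  archimedean {Q.mkℚ (ℤ.+ zero) d _} (Q.*<* (ℤ.+<+ ()))
  archimedean {Q.mkℚ (ℤ.-[1+ n ]) d _} (Q.*<* ())
  -- Here ε is (n + 1)/(d + 1), and 1/(d + 2) < 1/(d + 1) ≤ ε.
  archimedean {ε@(Q.mkℚ (ℤ.+[1+ n ]) d _)} _ = suc (suc d) , s≤s z≤n , QP.toℚᵘ-cancel-< (begin-strict
    Q.toℚᵘ (frac 1 (suc (suc d))) ≃⟨ frac≃ 1 (suc d) ⟩
    ℚᵘ.mkℚᵘ (ℤ.+ 1) (suc d) <⟨ ℚᵘ.*<* (ℤ.+<+ lt) ⟩
    ℚᵘ.mkℚᵘ (ℤ.+ suc n) d ∎)
    where
    open ℚᵘP.≤-Reasoning
    lt : 1 ℕ.* suc d ℕ.< suc n ℕ.* suc (suc d)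
    lt = ℕP.≤-trans (s≤s (ℕP.≤-reflexive (ℕP.*-identityˡ (suc d)))) (ℕP.m≤n*m (suc (suc d)) (suc n))

*-monoˡ : ∀ {r p q} → 0ℚ Q.≤ r → p Q.≤ q → r * p Q.≤ r * q
*-monoˡ {r} 0≤r = QP.*-monoˡ-≤-nonNeg r {{Q.nonNegative 0≤r}}

*-monoʳ : ∀ {r p q} → 0ℚ Q.≤ r → p Q.≤ q → p * r Q.≤ q * r
*-monoʳ {r} 0≤r = QP.*-monoʳ-≤-nonNeg r {{Q.nonNegative 0≤r}}

0≤* : ∀ {p q} → 0ℚ Q.≤ p → 0ℚ Q.≤ q → 0ℚ Q.≤ p * q
0≤* {p} {q} 0≤p 0≤q = subst (Q._≤ p * q) (QP.*-zeroʳ p) (*-monoˡ 0≤p 0≤q)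

0≤+ : ∀ {p q} → 0ℚ Q.≤ p → 0ℚ Q.≤ q → 0ℚ Q.≤ p + q
0≤+ 0≤p 0≤q = QP.+-mono-≤ 0≤p 0≤q

≤⇒0≤- : ∀ {p q} → p Q.≤ q → 0ℚ Q.≤ q - p
≤⇒0≤- {p} {q} p≤q = subst (Q._≤ q - p) (QP.+-inverseʳ p) (QP.+-monoˡ-≤ (- p) p≤q)

-- Inequalities are certified by exhibiting the difference of the two sides as a
-- combination of nonnegative terms, the identity being left to the ring solver.
≤-certify : ∀ {p q} d → 0ℚ Q.≤ d → q - p ≡ d → p Q.≤ q
≤-certify {p} {q} d 0≤d eq = subst₂ Q._≤_ (QP.+-identityˡ p) (trans (cong (_+ p) (sym eq)) (solve 2 (λ q p → q :- p :+ p := q) refl q p)) (QP.+-monoˡ-≤ p 0≤d)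

*-cancelˡ-ι : ∀ {n p q} → 1 ≤ n → ι n * p Q.≤ ι n * q → p Q.≤ q
*-cancelˡ-ι {n} {p} {q} 1≤n h = subst₂ Q._≤_ (lemma p) (lemma q) (*-monoˡ (0≤inv n) h)
  where
  lemma : ∀ x → inv n * (ι n * x) ≡ x
  lemma x = trans (solve 3 (λ i k x → i :* (k :* x) := k :* i :* x) refl (inv n) (ι n) x)
                  (trans (cong (_* x) (ι*inv 1≤n)) (QP.*-identityˡ x))

ι-mono : ∀ {m n} → m ≤ n → ι m Q.≤ ι n
ι-mono {m} {n} m≤n = subst₂ Q._≤_ (QP.+-identityʳ (ι m))
  (trans (sym (ι-+ m (n ℕ.∸ m))) (cong ι (ℕP.m+[n∸m]≡n m≤n)))
  (QP.+-monoʳ-≤ (ι m) (0≤ι (n ℕ.∸ m)))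

≤⇒*inv≤ : ∀ {n p q} → 1 ≤ n → p Q.≤ ι n * q → p * inv n Q.≤ q
≤⇒*inv≤ {n} {p} {q} 1≤n h = subst (p * inv n Q.≤_)
  (trans (solve 3 (λ k q i → k :* q :* i := k :* i :* q) refl (ι n) q (inv n))
         (trans (cong (_* q) (ι*inv 1≤n)) (QP.*-identityˡ q)))
  (*-monoʳ (0≤inv n) h)

≤-*inv : ∀ {n p q} → 1 ≤ n → ι n * p Q.≤ q → p Q.≤ q * inv n
≤-*inv {n} {p} {q} 1≤n h = subst (Q._≤ q * inv n)
  (trans (solve 3 (λ k p i → k :* p :* i := k :* i :* p) refl (ι n) p (inv n))
         (trans (cong (_* p) (ι*inv 1≤n)) (QP.*-identityˡ p)))
  (*-monoʳ (0≤inv n) h)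

inv-antimono : ∀ {m n} → 1 ≤ m → m ≤ n → inv n Q.≤ inv m
inv-antimono {m} {n} 1≤m m≤n = subst (Q._≤ inv m) (QP.*-identityˡ (inv n))
  (≤⇒*inv≤ (ℕP.≤-trans 1≤m m≤n)
    (subst (Q._≤ ι n * inv m) (ι*inv 1≤m) (*-monoʳ (0≤inv m) (ι-mono m≤n))))

frac-≤ : ∀ {a b c d} → 1 ≤ b → 1 ≤ d → a ℕ.* d ≤ c ℕ.* b → ι a * inv b Q.≤ ι c * inv d
frac-≤ {a} {b} {c} {d} 1≤b 1≤d h = ≤⇒*inv≤ 1≤b (subst (ι a Q.≤_)
  (solve 3 (λ c b d → c :* b :* d := b :* (c :* d)) refl (ι c) (ι b) (inv d))
  (≤-*inv 1≤d (subst₂ Q._≤_ (trans (cong ι (ℕP.*-comm a d)) (ι-* d a)) (ι-* c b) (ι-mono h))))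

inv≤1 : ∀ n → inv n Q.≤ 1ℚ
inv≤1 zero = subst₂ Q._≤_ (trans ι-0 (sym inv-0)) ι-1 (ι-mono z≤n)
inv≤1 (suc n) = subst₂ Q._≤_ (QP.*-identityˡ _) refl (≤⇒*inv≤ {suc n} (s≤s z≤n) (subst₂ Q._≤_ ι-1 (sym (QP.*-identityʳ _)) (ι-mono {1} {suc n} (s≤s z≤n))))

∣-∣≤ : ∀ {x y e} → x Q.≤ y + e → y Q.≤ x + e → Q.∣ x - y ∣ Q.≤ e
∣-∣≤ {x} {y} {e} h₁ h₂ with QP.∣p∣≡p∨∣p∣≡-p (x - y)
... | inj₁ eq = subst (Q._≤ e) (sym eq) (≤-certify _ (≤⇒0≤- h₁) (solve 3 (λ x y e → e :- (x :- y) := y :+ e :- x) refl x y e))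
... | inj₂ eq = subst (Q._≤ e) (sym eq) (≤-certify _ (≤⇒0≤- h₂) (solve 3 (λ x y e → e :- (:- (x :- y)) := x :+ e :- y) refl x y e))

-- Finite sums and indicators

S : (ℕ → ℚ) → ℕ → ℚ
S f zero = 0ℚ
S f (suc n) = S f n + f (suc n)

S-cong : ∀ {f g} n → (∀ i → 1 ≤ i → i ≤ n → f i ≡ g i) → S f n ≡ S g n
S-cong zero h = refl
S-cong (suc n) h = cong₂ _+_ (S-cong n λ i 1≤i i≤n → h i 1≤i (ℕP.m≤n⇒m≤1+n i≤n)) (h (suc n) (s≤s z≤n) ℕP.≤-refl)

S-mono : ∀ {f g} n → (∀ i → 1 ≤ i → i ≤ n → f i Q.≤ g i) → S f n Q.≤ S g n
S-mono zero h = QP.≤-refl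
S-mono (suc n) h = QP.+-mono-≤ (S-mono n λ i 1≤i i≤n → h i 1≤i (ℕP.m≤n⇒m≤1+n i≤n)) (h (suc n) (s≤s z≤n) ℕP.≤-refl)

S-zero : ∀ n → S (λ _ → 0ℚ) n ≡ 0ℚ
S-zero zero = refl
S-zero (suc n) = trans (QP.+-identityʳ _) (S-zero n)

S-≡0 : ∀ {f} n → (∀ i → 1 ≤ i → i ≤ n → f i ≡ 0ℚ) → S f n ≡ 0ℚ
S-≡0 n h = trans (S-cong n h) (S-zero n)

0≤S : ∀ {f} n → (∀ i → 0ℚ Q.≤ f i) → 0ℚ Q.≤ S f n
0≤S zero h = QP.≤-refl
0≤S (suc n) h = 0≤+ (0≤S n h) (h (suc n))

S-+ : ∀ f g n → S (λ i → f i + g i) n ≡ S f n + S g n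
S-+ f g zero = refl
S-+ f g (suc n) = trans (cong (_+ (f (suc n) + g (suc n))) (S-+ f g n))
  (solve 4 (λ a b x y → a :+ b :+ (x :+ y) := a :+ x :+ (b :+ y)) refl (S f n) (S g n) (f (suc n)) (g (suc n)))

S-*ˡ : ∀ c f n → S (λ i → c * f i) n ≡ c * S f n
S-*ˡ c f zero = sym (QP.*-zeroʳ c)
S-*ˡ c f (suc n) = trans (cong (_+ c * f (suc n)) (S-*ˡ c f n)) (sym (QP.*-distribˡ-+ c _ _))

S-*ʳ : ∀ c f n → S (λ i → f i * c) n ≡ S f n * c
S-*ʳ c f n = trans (S-cong n λ i _ _ → QP.*-comm (f i) c) (trans (S-*ˡ c f n) (QP.*-comm c _))

S-const : ∀ c n → S (λ _ → c) n ≡ ι n * c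
S-const c zero = sym (trans (cong (_* c) ι-0) (QP.*-zeroˡ c))
S-const c (suc n) = trans (cong (_+ c) (S-const c n))
  (trans (solve 2 (λ k c → k :* c :+ c := (k :+ con 1ℚ) :* c) refl (ι n) c)
         (cong (_* c) (trans (cong (ι n +_) (sym ι-1)) (trans (sym (ι-+ n 1)) (cong ι (ℕP.+-comm n 1))))))

S-swap : ∀ (f : ℕ → ℕ → ℚ) m n → S (λ i → S (f i) n) m ≡ S (λ j → S (λ i → f i j) m) n
S-swap f zero n = sym (S-zero n)
S-swap f (suc m) n = trans (cong (_+ S (f (suc m)) n) (S-swap f m n)) (sym (S-+ (λ j → S (λ i → f i j) m) (f (suc m)) n))

S-split : ∀ f m n → S f (m ℕ.+ n) ≡ S f m + S (λ i → f (m ℕ.+ i)) n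
S-split f m zero = trans (cong (S f) (ℕP.+-identityʳ m)) (sym (QP.+-identityʳ _))
S-split f m (suc n) = trans (cong (S f) (ℕP.+-suc m n))
  (trans (cong₂ _+_ (S-split f m n) (cong f (sym (ℕP.+-suc m n)))) (QP.+-assoc (S f m) (S (λ i → f (m ℕ.+ i)) n) (f (m ℕ.+ suc n))))

S-extend : ∀ {f m n} → (∀ i → 0ℚ Q.≤ f i) → m ≤ n → S f m Q.≤ S f n
S-extend {f} {m} {n} 0≤f m≤n = subst₂ Q._≤_ (QP.+-identityʳ _)
  (trans (sym (S-split f m (n ∸ m))) (cong (S f) (ℕP.m+[n∸m]≡n m≤n)))
  (QP.+-monoʳ-≤ (S f m) (0≤S (n ∸ m) λ i → 0≤f (m ℕ.+ i)))

term≤S : ∀ {f} n j → (∀ i → 0ℚ Q.≤ f i) → 1 ≤ j → j ≤ n → f j Q.≤ S f n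
term≤S {f} n (suc j) 0≤f _ j≤n = QP.≤-trans
  (subst (Q._≤ S f j + f (suc j)) (QP.+-identityˡ _) (QP.+-monoˡ-≤ (f (suc j)) (0≤S j 0≤f)))
  (S-extend 0≤f j≤n)

S-single-≤ : ∀ {f} n j → 0ℚ Q.≤ f j → (∀ i → 1 ≤ i → i ≤ n → i ≢ j → f i ≡ 0ℚ) → S f n Q.≤ f j
S-single-≤ zero j 0≤fj h = 0≤fj
S-single-≤ {f} (suc n) j 0≤fj h with suc n ℕ.≟ j
... | yes refl = QP.≤-reflexive (trans (cong (_+ f (suc n)) (S-≡0 n λ i 1≤i i≤n → h i 1≤i (ℕP.m≤n⇒m≤1+n i≤n) (ℕP.<⇒≢ (s≤s i≤n)))) (QP.+-identityˡ _))
... | no n≢j = subst (λ x → S f n + x Q.≤ f j) (sym (h (suc n) (s≤s z≤n) ℕP.≤-refl n≢j))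
  (subst (Q._≤ f j) (sym (QP.+-identityʳ _)) (S-single-≤ n j 0≤fj λ i 1≤i i≤n → h i 1≤i (ℕP.m≤n⇒m≤1+n i≤n)))

S-single : ∀ {f} n j → (∀ i → 0ℚ Q.≤ f i) → 1 ≤ j → j ≤ n → (∀ i → 1 ≤ i → i ≤ n → i ≢ j → f i ≡ 0ℚ) → S f n ≡ f j
S-single n j 0≤f 1≤j j≤n h = QP.≤-antisym (S-single-≤ n j (0≤f j) h) (term≤S n j 0≤f 1≤j j≤n)

S-periodic : ∀ {f K} a → (∀ i → f (K ℕ.+ i) ≡ f i) → S f (a ℕ.* K) ≡ ι a * S f K
S-periodic {f} {K} zero per = sym (trans (cong (_* S f K) ι-0) (QP.*-zeroˡ (S f K)))
S-periodic {f} {K} (suc a) per = begin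
  S f (K ℕ.+ a ℕ.* K)                            ≡⟨ S-split f K (a ℕ.* K) ⟩
  S f K + S (λ i → f (K ℕ.+ i)) (a ℕ.* K)        ≡⟨ cong (S f K +_) (S-cong (a ℕ.* K) λ i _ _ → per i) ⟩
  S f K + S f (a ℕ.* K)                          ≡⟨ cong (S f K +_) (S-periodic a per) ⟩
  S f K + ι a * S f K                            ≡⟨ solve 2 (λ s a → s :+ a :* s := (con 1ℚ :+ a) :* s) refl (S f K) (ι a) ⟩
  (1ℚ + ι a) * S f K                             ≡⟨ cong (λ x → (x + ι a) * S f K) (sym ι-1) ⟩
  (ι 1 + ι a) * S f K                            ≡⟨ cong (_* S f K) (sym (ι-+ 1 a)) ⟩
  ι (suc a) * S f K                              ∎
  where open ≡-Reasoning

ind : {P : Set} → Dec P → ℚ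
ind d = if does d then 1ℚ else 0ℚ

ind-yes : ∀ {P : Set} (d : Dec P) → P → ind d ≡ 1ℚ
ind-yes (yes _) _ = refl
ind-yes (no ¬p) p = ⊥-elim (¬p p)

ind-no : ∀ {P : Set} (d : Dec P) → ¬ P → ind d ≡ 0ℚ
ind-no (yes p) ¬p = ⊥-elim (¬p p)
ind-no (no _) _ = refl

0≤1 : 0ℚ Q.≤ 1ℚ
0≤1 = subst (0ℚ Q.≤_) ι-1 (0≤ι 1)

0≤ind : ∀ {P : Set} (d : Dec P) → 0ℚ Q.≤ ind d
0≤ind (yes _) = 0≤1
0≤ind (no _) = QP.≤-refl

ind≤1 : ∀ {P : Set} (d : Dec P) → ind d Q.≤ 1ℚ
ind≤1 (yes _) = QP.≤-refl
ind≤1 (no _) = 0≤1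

ind-mono : ∀ {P R : Set} (d : Dec P) (e : Dec R) → (P → R) → ind d Q.≤ ind e
ind-mono (yes p) e f = QP.≤-reflexive (sym (ind-yes e (f p)))
ind-mono (no _) e f = 0≤ind e

ind-cong : ∀ {P R : Set} (d : Dec P) (e : Dec R) → (P → R) → (R → P) → ind d ≡ ind e
ind-cong d e f g = QP.≤-antisym (ind-mono d e f) (ind-mono e d g)

ind-× : ∀ {P R : Set} (d : Dec P) (e : Dec R) → ind (d ×-dec e) ≡ ind d * ind e
ind-× (yes _) (yes _) = sym (QP.*-identityˡ 1ℚ)
ind-× (yes _) (no _) = sym (QP.*-zeroʳ 1ℚ)
ind-× (no _) e = sym (QP.*-zeroˡ (ind e))

ind*≤ : ∀ {P : Set} (d : Dec P) {x y} → 0ℚ Q.≤ y → (P → x Q.≤ y) → ind d * x Q.≤ y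
ind*≤ (yes p) {x} 0≤y h = subst (Q._≤ _) (sym (QP.*-identityˡ x)) (h p)
ind*≤ (no _) {x} 0≤y h = subst (Q._≤ _) (sym (QP.*-zeroˡ x)) 0≤y

ind*-cong : ∀ {P : Set} (d : Dec P) {x y} → (P → x ≡ y) → ind d * x ≡ ind d * y
ind*-cong (yes p) h = cong (1ℚ *_) (h p)
ind*-cong (no _) {x} {y} h = trans (QP.*-zeroˡ x) (sym (QP.*-zeroˡ y))

S-ind-unique : ∀ {P : ℕ → Set} (d : ∀ i → Dec (P i)) n → (∀ i j → 1 ≤ i → i ≤ n → 1 ≤ j → j ≤ n → P i → P j → i ≡ j) → S (λ i → ind (d i)) n Q.≤ 1ℚ
S-ind-unique d zero uniq = 0≤1
S-ind-unique d (suc n) uniq with d (suc n)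
... | no ¬p = subst (Q._≤ 1ℚ) (sym (QP.+-identityʳ _))
  (S-ind-unique d n λ i j 1≤i i≤n 1≤j j≤n → uniq i j 1≤i (ℕP.m≤n⇒m≤1+n i≤n) 1≤j (ℕP.m≤n⇒m≤1+n j≤n))
... | yes p = QP.≤-reflexive (trans (cong (_+ 1ℚ) (S-≡0 n λ i 1≤i i≤n → ind-no (d i) λ q →
  ℕP.<⇒≢ (s≤s i≤n) (uniq i (suc n) 1≤i (ℕP.m≤n⇒m≤1+n i≤n) (s≤s z≤n) ℕP.≤-refl q p))) (QP.+-identityˡ 1ℚ))

-- Each block of `j` consecutive integers contains one multiple of `j`, its last element. The
-- induction shifts `f` by one block.
S-multiples : ∀ {j} a f → 1 ≤ j → S (λ n → ind (j ∣? n) * f n) (a ℕ.* j) ≡ S (λ v → f (v ℕ.* j)) a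
S-multiples zero f _ = refl
S-multiples {j} (suc a) f 1≤j = begin
  S g (j ℕ.+ a ℕ.* j)                                ≡⟨ S-split g j (a ℕ.* j) ⟩
  S g j + S (λ i → g (j ℕ.+ i)) (a ℕ.* j)            ≡⟨ cong₂ _+_ (first 1≤j) (S-cong (a ℕ.* j) λ i _ _ → cong (_* f (j ℕ.+ i)) (shift i)) ⟩
  f (1 ℕ.* j) + S (λ i → ind (j ∣? i) * f (j ℕ.+ i)) (a ℕ.* j) ≡⟨ cong₂ _+_ (sym (QP.+-identityˡ (f (1 ℕ.* j)))) (S-multiples a (λ i → f (j ℕ.+ i)) 1≤j) ⟩
  S (λ v → f (v ℕ.* j)) 1 + S (λ v → f (suc v ℕ.* j)) a ≡⟨ sym (S-split (λ v → f (v ℕ.* j)) 1 a) ⟩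
  S (λ v → f (v ℕ.* j)) (suc a)                       ∎
  where
  open ≡-Reasoning
  g : ℕ → ℚ
  g n = ind (j ∣? n) * f n
  shift : ∀ i → ind (j ∣? (j ℕ.+ i)) ≡ ind (j ∣? i)
  shift i = ind-cong (j ∣? (j ℕ.+ i)) (j ∣? i) (λ h → ∣m+n∣m⇒∣n h ∣-refl) (∣m∣n⇒∣m+n ∣-refl)
  first : 1 ≤ j → S g j ≡ f (1 ℕ.* j)
  first (s≤s {n = k} _) = trans
    (cong₂ _+_ (S-≡0 k λ { i@(suc _) _ i≤k → trans (cong (_* f i) (ind-no (j ∣? i) λ h → ℕP.<⇒≱ (s≤s i≤k) (∣⇒≤ h))) (QP.*-zeroˡ (f i)) })
               (trans (cong (_* f j) (ind-yes (j ∣? j) ∣-refl)) (QP.*-identityˡ (f j))))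
    (trans (QP.+-identityˡ (f j)) (cong f (sym (ℕP.*-identityˡ j))))

-- The incomplete block after the last multiple of `k` contributes nothing. With no rounding term,
-- the bound can be summed over all `k` up to N.
S-ind∣≤ : ∀ {k} N → 1 ≤ k → S (λ n → ind (k ∣? n)) N Q.≤ ι N * inv k
S-ind∣≤ {k} N 1≤k = ≤-*inv 1≤k (subst (λ x → ι k * S g x Q.≤ ι N) (sym N≡)
  (subst (λ x → ι k * x Q.≤ ι N) (sym (trans (S-split g (b ℕ.* k) r) (trans (cong₂ _+_ main rest) (QP.+-identityʳ _))))
    (subst (Q._≤ ι N) (ι-* k b) (ι-mono (subst (_≤ N) (ℕP.*-comm b k) (subst (b ℕ.* k ≤_) (sym N≡) (ℕP.m≤m+n _ _)))))))
  where
  instance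
    k≢0 : NonZero k
    k≢0 = ℕ.>-nonZero 1≤k
  g : ℕ → ℚ
  g n = ind (k ∣? n)
  b r : ℕ
  b = N ℕ./ k
  r = N ℕ.% k
  N≡ : N ≡ b ℕ.* k ℕ.+ r
  N≡ = trans (m≡m%n+[m/n]*n N k) (ℕP.+-comm r (b ℕ.* k))
  main : S g (b ℕ.* k) ≡ ι b
  main = trans (S-cong (b ℕ.* k) λ n _ _ → sym (QP.*-identityʳ (g n)))
    (trans (S-multiples b (λ _ → 1ℚ) 1≤k) (trans (S-const 1ℚ b) (QP.*-identityʳ _)))
  rest : S (λ i → g (b ℕ.* k ℕ.+ i)) r ≡ 0ℚ
  rest = S-≡0 r λ { i@(suc _) _ i≤r → ind-no (k ∣? (b ℕ.* k ℕ.+ i)) λ h →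
    ℕP.<⇒≱ (ℕP.≤-<-trans i≤r (m%n<n N k)) (∣⇒≤ (∣m+n∣m⇒∣n h (n∣m*n b))) }

-- The whole periods are exact. On the remaining r < K places, both the sum of `f` and r times its
-- mean lie between 0 and `K`.
S-periodic-average : ∀ {f K} N → 1 ≤ K → (∀ i → f (K ℕ.+ i) ≡ f i) → (∀ i → 0ℚ Q.≤ f i) → (∀ i → f i Q.≤ 1ℚ) →
  (S f N Q.≤ ι N * (inv K * S f K) + ι K) × (ι N * (inv K * S f K) Q.≤ S f N + ι K)
S-periodic-average {f} {K} N 1≤K per 0≤f f≤1 =
    ≤-certify (ι K - S f r + ι r * (inv K * S f K)) (0≤+ (≤⇒0≤- (Sf≤ r r≤K)) (0≤* (0≤ι r) 0≤mean))
      (trans (cong (λ x → x + ι K - S f N) mean≡) (trans (cong (λ x → ι b * S f K + ι r * (inv K * S f K) + ι K - x) sum≡)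
        (solve 4 (λ x y k s → x :+ y :+ k :- (x :+ s) := k :- s :+ y) refl (ι b * S f K) (ι r * (inv K * S f K)) (ι K) (S f r))))
  , ≤-certify (S f r + (ι K - ι r * (inv K * S f K))) (0≤+ (0≤S r 0≤f) (≤⇒0≤- mean≤))
      (trans (cong (λ x → S f N + ι K - x) mean≡) (trans (cong (λ x → x + ι K - (ι b * S f K + ι r * (inv K * S f K))) sum≡)
        (solve 4 (λ x y k s → x :+ s :+ k :- (x :+ y) := s :+ (k :- y)) refl (ι b * S f K) (ι r * (inv K * S f K)) (ι K) (S f r))))
  where
  instance
    K≢0 : NonZero K
    K≢0 = ℕ.>-nonZero 1≤K
  b r : ℕ
  b = N ℕ./ K
  r = N ℕ.% K
  r≤K : r ≤ K
  r≤K = ℕP.<⇒≤ (m%n<n N K)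
  N≡ : N ≡ b ℕ.* K ℕ.+ r
  N≡ = trans (m≡m%n+[m/n]*n N K) (ℕP.+-comm r (b ℕ.* K))
  per* : ∀ a i → f (a ℕ.* K ℕ.+ i) ≡ f i
  per* zero i = refl
  per* (suc a) i = trans (cong f (ℕP.+-assoc K (a ℕ.* K) i)) (trans (per _) (per* a i))
  sum≡ : S f N ≡ ι b * S f K + S f r
  sum≡ = trans (cong (S f) N≡) (trans (S-split f (b ℕ.* K) r) (cong₂ _+_ (S-periodic b per) (S-cong r λ i _ _ → per* b i)))
  mean≡ : ι N * (inv K * S f K) ≡ ι b * S f K + ι r * (inv K * S f K)
  mean≡ = trans (cong (λ x → x * (inv K * S f K)) (trans (cong ι N≡) (trans (ι-+ (b ℕ.* K) r) (cong (_+ ι r) (ι-* b K)))))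
    (trans (solve 5 (λ b k r i s → (b :* k :+ r) :* (i :* s) := b :* (k :* i) :* s :+ r :* (i :* s)) refl (ι b) (ι K) (ι r) (inv K) (S f K))
      (cong (λ x → x * S f K + ι r * (inv K * S f K)) (trans (cong (ι b *_) (ι*inv 1≤K)) (QP.*-identityʳ (ι b)))))
  0≤mean : 0ℚ Q.≤ inv K * S f K
  0≤mean = 0≤* (0≤inv K) (0≤S K 0≤f)
  Sf≤ι : ∀ m → S f m Q.≤ ι m
  Sf≤ι m = subst (S f m Q.≤_) (trans (S-const 1ℚ m) (QP.*-identityʳ _)) (S-mono m λ i _ _ → f≤1 i)
  Sf≤ : ∀ m → m ≤ K → S f m Q.≤ ι K
  Sf≤ m m≤K = QP.≤-trans (Sf≤ι m) (ι-mono m≤K)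
  mean≤ : ι r * (inv K * S f K) Q.≤ ι K
  mean≤ = QP.≤-trans (*-monoʳ 0≤mean (ι-mono r≤K)) (subst (Q._≤ ι K)
    (trans (sym (QP.*-identityˡ (S f K))) (trans (cong (_* S f K) (sym (ι*inv 1≤K))) (QP.*-assoc (ι K) (inv K) (S f K)))) (Sf≤ K ℕP.≤-refl))

-- Euler's function

range1-suc : ∀ n → range1 (suc n) ≡ range1 n ++ suc n ∷ []
range1-suc n = trans (cong (map suc) (sym (ListP.applyUpTo-∷ʳ (λ i → i) n))) (ListP.map-++ suc (upTo n) (n ∷ []))

sumℚ-++ : ∀ xs ys → sumℚ (xs ++ ys) ≡ sumℚ xs + sumℚ ys
sumℚ-++ [] ys = sym (QP.+-identityˡ (sumℚ ys))
sumℚ-++ (x ∷ xs) ys = trans (cong (x +_) (sumℚ-++ xs ys)) (sym (QP.+-assoc x (sumℚ xs) (sumℚ ys)))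

sumℚ-range1 : ∀ f n → sumℚ (map f (range1 n)) ≡ S f n
sumℚ-range1 f zero = refl
sumℚ-range1 f (suc n) = begin
  sumℚ (map f (range1 (suc n)))                ≡⟨ cong (λ xs → sumℚ (map f xs)) (range1-suc n) ⟩
  sumℚ (map f (range1 n ++ suc n ∷ []))        ≡⟨ cong sumℚ (ListP.map-++ f (range1 n) (suc n ∷ [])) ⟩
  sumℚ (map f (range1 n) ++ f (suc n) ∷ [])    ≡⟨ sumℚ-++ (map f (range1 n)) (f (suc n) ∷ []) ⟩
  sumℚ (map f (range1 n)) + (f (suc n) + 0ℚ)   ≡⟨ cong₂ _+_ (sumℚ-range1 f n) (QP.+-identityʳ (f (suc n))) ⟩
  S f (suc n)                                  ∎
  where open ≡-Reasoning

sumℚ-filter : ∀ {P : ℕ → Set} (P? : ∀ i → Dec (P i)) f xs → sumℚ (map f (filter P? xs)) ≡ sumℚ (map (λ i → ind (P? i) * f i) xs)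
sumℚ-filter P? f [] = refl
sumℚ-filter P? f (x ∷ xs) with P? x
... | yes _ = cong₂ _+_ (sym (QP.*-identityˡ (f x))) (sumℚ-filter P? f xs)
... | no _ = trans (sumℚ-filter P? f xs) (sym (trans (cong (_+ rest) (QP.*-zeroˡ (f x))) (QP.+-identityˡ rest)))
  where
  rest : ℚ
  rest = sumℚ (map (λ i → ind (P? i) * f i) xs)

length-filter : ∀ {P : ℕ → Set} (P? : ∀ i → Dec (P i)) xs → ι (List.length (filter P? xs)) ≡ sumℚ (map (λ i → ind (P? i)) xs)
length-filter P? [] = ι-0
length-filter P? (x ∷ xs) with P? x
... | yes _ = trans (ι-+ 1 _) (cong₂ _+_ ι-1 (length-filter P? xs))
... | no _ = trans (length-filter P? xs) (sym (QP.+-identityˡ _))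

ι-cancel-≤ : ∀ {m n} → ι m Q.≤ ι n → m ≤ n
ι-cancel-≤ {m} {n} h with m ℕ.≤? n
... | yes m≤n = m≤n
... | no m≰n = ⊥-elim (QP.1≢0 (QP.≤-antisym
  (≤-certify _ (≤⇒0≤- (QP.≤-trans (subst (Q._≤ ι m) (ι-+ 1 n) (ι-mono (ℕP.≰⇒> m≰n))) h))
    (trans (cong (λ x → 0ℚ - x) (sym ι-1)) (solve 2 (λ x y → con 0ℚ :- y := x :- (y :+ x)) refl (ι n) (ι 1))))
  0≤1))

coprime? : ∀ m u → Dec (gcd u m ≡ 1)
coprime? m u = gcd u m ℕ.≟ 1

ι-φ : ∀ m → ι (φ m) ≡ S (λ u → ind (coprime? m u)) m
ι-φ m = trans (length-filter (coprime? m) (range1 m)) (sumℚ-range1 (λ u → ind (coprime? m u)) m)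

φ≤ : ∀ m → φ m ≤ m
φ≤ m = ι-cancel-≤ (subst₂ Q._≤_ (sym (ι-φ m)) (trans (S-const 1ℚ m) (QP.*-identityʳ (ι m))) (S-mono m λ u _ _ → ind≤1 (coprime? m u)))

1≤φ : ∀ {m} → 1 ≤ m → 1 ≤ φ m
1≤φ {m} 1≤m = ι-cancel-≤ (subst₂ Q._≤_ (trans (ind-yes (coprime? m 1) (∣1⇒≡1 (gcd[m,n]∣m 1 m))) (sym ι-1)) (sym (ι-φ m))
  (term≤S m 1 (λ u → 0≤ind (coprime? m u)) (s≤s z≤n) 1≤m))

count-coprime : ∀ a d → S (λ u → ind (coprime? d u)) (a ℕ.* d) ≡ ι a * ι (φ d)
count-coprime a d = trans (S-periodic a λ i → cong (λ g → ind (g ℕ.≟ 1)) (gcd-periodic d i)) (cong (ι a *_) (sym (ι-φ d)))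

-- Coprime to `a * d` implies coprime to `d`, and the range up to `a * d` consists of `a` periods of
-- `d`. Every upper bound that improves on `ρ≤1` comes from here.
φ-*-≤ : ∀ a d → φ (a ℕ.* d) ≤ a ℕ.* φ d
φ-*-≤ a d = ι-cancel-≤ (subst₂ Q._≤_ (sym (ι-φ (a ℕ.* d))) (trans (count-coprime a d) (sym (ι-* a (φ d))))
  (S-mono (a ℕ.* d) λ u _ _ → ind-mono (coprime? (a ℕ.* d) u) (coprime? d u) (gcd≡1-∣ {u} {u} {a ℕ.* d} {d} ∣-refl (n∣m*n a))))

New : ℕ → ℕ → ℕ → Set
New m d ℓ = Prime ℓ × ℓ ∣ m × ¬ ℓ ∣ d

new? : ∀ m d ℓ → Dec (New m d ℓ)
new? m d ℓ = prime? ℓ ×-dec (ℓ ∣? m ×-dec ¬? (ℓ ∣? d))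

-- The R of the sieve.
newSum : ℕ → ℕ → ℚ
newSum m d = S (λ ℓ → ind (new? m d ℓ) * inv ℓ) m

0≤newSum : ∀ m d → 0ℚ Q.≤ newSum m d
0≤newSum m d = 0≤S m λ ℓ → 0≤* (0≤ind (new? m d ℓ)) (0≤inv ℓ)

ι-cofactor : ∀ {a b j} → 1 ≤ j → a ≡ b ℕ.* j → ι b ≡ ι a * inv j
ι-cofactor {b = b} {j} 1≤j refl = sym (trans (cong (_* inv j) (ι-* b j)) (trans (QP.*-assoc (ι b) (ι j) (inv j))
  (trans (cong (ι b *_) (ι*inv 1≤j)) (QP.*-identityʳ (ι b)))))

-- Exact, because `ℓ` must divide `a`: with `a = c * ℓ`, the multiples `v * ℓ` have `v` running
-- through `c` whole periods of `d`, and the factor `ℓ` does not affect coprimality to `d`.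
count-coprime-multiples : ∀ a {d ℓ} → 1 ≤ d → New (a ℕ.* d) d ℓ →
  S (λ u → ind (ℓ ∣? u) * ind (coprime? d u)) (a ℕ.* d) ≡ ι a * ι (φ d) * inv ℓ
count-coprime-multiples a {d} {ℓ} 1≤d (pℓ , ℓ∣ad , ℓ∤d) with euclidsLemma a d pℓ ℓ∣ad
... | inj₂ ℓ∣d = ⊥-elim (ℓ∤d ℓ∣d)
... | inj₁ (divides c refl) = begin
  S f (c ℕ.* ℓ ℕ.* d)                                  ≡⟨ cong (S f) (trans (ℕP.*-assoc c ℓ d) (trans (cong (c ℕ.*_) (ℕP.*-comm ℓ d)) (sym (ℕP.*-assoc c d ℓ)))) ⟩
  S f (c ℕ.* d ℕ.* ℓ)                                  ≡⟨ S-multiples (c ℕ.* d) (λ u → ind (coprime? d u)) 1≤ℓ ⟩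
  S (λ v → ind (coprime? d (v ℕ.* ℓ))) (c ℕ.* d)       ≡⟨ S-cong (c ℕ.* d) (λ v _ _ → ind-cong (coprime? d (v ℕ.* ℓ)) (coprime? d v) (gcd≡1-∣ {v ℕ.* ℓ} {v} {d} {d} (m∣m*n ℓ) ∣-refl) (gcd-absorb-prime v pℓ 1≤d ℓ∤d)) ⟩
  S (λ v → ind (coprime? d v)) (c ℕ.* d)               ≡⟨ count-coprime c d ⟩
  ι c * ι (φ d)                                        ≡⟨ cong (_* ι (φ d)) (ι-cofactor {c ℕ.* ℓ} 1≤ℓ refl) ⟩
  ι (c ℕ.* ℓ) * inv ℓ * ι (φ d)                        ≡⟨ solve 3 (λ x y z → x :* y :* z := x :* z :* y) refl (ι (c ℕ.* ℓ)) (inv ℓ) (ι (φ d)) ⟩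
  ι (c ℕ.* ℓ) * ι (φ d) * inv ℓ                        ∎
  where
  open ≡-Reasoning
  f : ℕ → ℚ
  f u = ind (ℓ ∣? u) * ind (coprime? d u)
  1≤ℓ : 1 ≤ ℓ
  1≤ℓ = ℕP.≤-trans (s≤s z≤n) (prime≥2 pℓ)

-- Sieve: an integer coprime to d but not to m is divisible by a prime factor of m not dividing d.
φ-sieve : ∀ a {d} → 1 ≤ a → 1 ≤ d → ι a * ι (φ d) Q.≤ ι (φ (a ℕ.* d)) + ι a * ι (φ d) * newSum (a ℕ.* d) d
φ-sieve a {d} 1≤a 1≤d = subst₂ Q._≤_ (count-coprime a d) right (S-mono m pointwise)
  where
  m : ℕ
  m = a ℕ.* d
  1≤m : 1 ≤ m
  1≤m = ℕP.*-mono-≤ 1≤a 1≤d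
  term : ℕ → ℕ → ℚ
  term u ℓ = ind (new? m d ℓ) * (ind (ℓ ∣? u) * ind (coprime? d u))
  0≤term : ∀ u ℓ → 0ℚ Q.≤ term u ℓ
  0≤term u ℓ = 0≤* (0≤ind (new? m d ℓ)) (0≤* (0≤ind (ℓ ∣? u)) (0≤ind (coprime? d u)))
  right : S (λ u → ind (coprime? m u) + S (term u) m) m ≡ ι (φ m) + ι a * ι (φ d) * newSum m d
  right = trans (S-+ (λ u → ind (coprime? m u)) (λ u → S (term u) m) m) (cong₂ _+_ (sym (ι-φ m))
    (trans (S-swap term m m) (trans (S-cong m λ ℓ _ _ →
      trans (S-*ˡ (ind (new? m d ℓ)) (λ u → ind (ℓ ∣? u) * ind (coprime? d u)) m)
        (trans (ind*-cong (new? m d ℓ) (count-coprime-multiples a 1≤d))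
          (solve 3 (λ x y z → x :* (y :* z) := y :* (x :* z)) refl (ind (new? m d ℓ)) (ι a * ι (φ d)) (inv ℓ))))
      (S-*ˡ (ι a * ι (φ d)) (λ ℓ → ind (new? m d ℓ) * inv ℓ) m))))
  pointwise : ∀ u → 1 ≤ u → u ≤ m → ind (coprime? d u) Q.≤ ind (coprime? m u) + S (term u) m
  pointwise u _ _ = helper (coprime? d u) (coprime? m u)
    where
    helper : Dec (gcd u d ≡ 1) → Dec (gcd u m ≡ 1) → ind (coprime? d u) Q.≤ ind (coprime? m u) + S (term u) m
    helper (no u∤d) _ = subst (Q._≤ ind (coprime? m u) + S (term u) m) (sym (ind-no (coprime? d u) u∤d)) (0≤+ (0≤ind (coprime? m u)) (0≤S m (0≤term u)))
    helper _ (yes cm) = subst₂ Q._≤_ (QP.+-identityʳ _) refl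
      (QP.+-mono-≤ (QP.≤-trans (ind≤1 (coprime? d u)) (QP.≤-reflexive (sym (ind-yes (coprime? m u) cm)))) (0≤S m (0≤term u)))
    helper (yes cd) (no ¬cm) with ∃-prime-factor (gcd≥1ʳ u 1≤m) ¬cm
    ... | p , pp , p∣g = subst₂ Q._≤_ (QP.+-identityˡ _) refl (QP.+-mono-≤ (0≤ind (coprime? m u))
      (QP.≤-trans (QP.≤-reflexive (sym term≡)) (term≤S m p (0≤term u) (ℕP.≤-trans (s≤s z≤n) (prime≥2 pp)) (∣⇒≤ {{ℕ.>-nonZero 1≤m}} p∣m))))
      where
      p∣u : p ∣ u
      p∣u = ∣-trans p∣g (gcd[m,n]∣m u m)
      p∣m : p ∣ m
      p∣m = ∣-trans p∣g (gcd[m,n]∣n u m)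
      term≡ : term u p ≡ ind (coprime? d u)
      term≡ = trans (cong₂ (λ x y → x * (y * ind (coprime? d u))) (ind-yes (new? m d p) (pp , p∣m , gcd≡1⇒∤prime cd pp p∣u)) (ind-yes (p ∣? u) p∣u))
        (trans (QP.*-identityˡ _) (QP.*-identityˡ _))

-- In the sieve with `a = p` only `p` itself can be new, so `newSum` is at most 1/p and φ(p d) ≥ (p
-- - 1) φ(d).
φ-prime-step : ∀ {p d} → Prime p → 1 ≤ d → φ d ≤ φ (p ℕ.* d)
φ-prime-step {p} {d} pp 1≤d = ι-cancel-≤ (≤-certify
    (ι (φ (p ℕ.* d)) + ι p * ι (φ d) * newSum (p ℕ.* d) d - ι p * ι (φ d) + (ι p * ι (φ d) * (inv p - newSum (p ℕ.* d) d) + (ι p - ι 2) * ι (φ d)))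
    (0≤+ (≤⇒0≤- (φ-sieve p 1≤p 1≤d)) (0≤+ (0≤* (0≤* (0≤ι p) (0≤ι (φ d))) (≤⇒0≤- newSum≤)) (0≤* (≤⇒0≤- (ι-mono (prime≥2 pp))) (0≤ι (φ d)))))
    (trans (cong (λ x → ι (φ (p ℕ.* d)) - x) (trans (sym (QP.*-identityˡ (ι (φ d)))) (cong (_* ι (φ d)) one≡)))
      (solve 6 (λ f p d n i t → f :- (t :- p :* i) :* d := f :+ p :* d :* n :- p :* d :+ (p :* d :* (i :- n) :+ (p :- t) :* d)) refl
        (ι (φ (p ℕ.* d))) (ι p) (ι (φ d)) (newSum (p ℕ.* d) d) (inv p) (ι 2))))
  where
  1≤p : 1 ≤ p
  1≤p = ℕP.≤-trans (s≤s z≤n) (prime≥2 pp)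
  -- The ring solver treats `inv p` as an atom; the relation `ι p * inv p ≡ 1ℚ` is fed to it through
  -- this coefficient of φ(d).
  one≡ : 1ℚ ≡ ι 2 - ι p * inv p
  one≡ = sym (trans (cong₂ _-_ (trans (ι-+ 1 1) (cong₂ _+_ ι-1 ι-1)) (ι*inv 1≤p)) refl)
  newSum≤ : newSum (p ℕ.* d) d Q.≤ inv p
  newSum≤ = QP.≤-trans (S-single-≤ (p ℕ.* d) p (0≤* (0≤ind (new? (p ℕ.* d) d p)) (0≤inv p)) other)
    (ind*≤ (new? (p ℕ.* d) d p) (0≤inv p) λ _ → QP.≤-refl)
    where
    other : ∀ i → 1 ≤ i → i ≤ p ℕ.* d → i ≢ p → ind (new? (p ℕ.* d) d i) * inv i ≡ 0ℚ
    other i _ _ i≢p = trans (cong (_* inv i) (ind-no (new? (p ℕ.* d) d i) ¬new)) (QP.*-zeroˡ (inv i))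
      where
      ¬new : ¬ New (p ℕ.* d) d i
      ¬new (pi , i∣pd , i∤d) with euclidsLemma p d pi i∣pd
      ... | inj₁ i∣p = i≢p (prime∣prime⇒≡ pi pp i∣p)
      ... | inj₂ i∣d = i∤d i∣d

φ-product : ∀ {d ps} → 1 ≤ d → All Prime ps → φ d ≤ φ (product ps ℕ.* d)
φ-product {d} _ [] = ℕP.≤-reflexive (cong φ (sym (ℕP.*-identityˡ d)))
φ-product {d} {p ∷ ps} 1≤d (pp ∷ pps) = ℕP.≤-trans (φ-product 1≤d pps)
  (subst (λ x → φ (product ps ℕ.* d) ≤ φ x) (sym (ℕP.*-assoc p (product ps) d))
    (φ-prime-step pp (ℕP.*-mono-≤ (productOfPrimes≥1 pps) 1≤d)))

-- The cofactor is multiplied in one prime at a time. In `gcdMean≤` this replaces each φ(K/r) by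
-- φ(K).
φ-mono-∣ : ∀ {d K} → 1 ≤ K → d ∣ K → φ d ≤ φ K
φ-mono-∣ {d} 1≤K (divides e refl) with 1≤*⇒1≤ e d 1≤K
... | 1≤e , 1≤d = subst (λ x → φ d ≤ φ (x ℕ.* d)) (sym (PrimeFactorisation.isFactorisation ps))
  (φ-product 1≤d (PrimeFactorisation.factorsPrime ps))
  where
  ps : PrimeFactorisation e
  ps = factorise e {{ℕ.>-nonZero 1≤e}}

-- Harmonic numbers and sums over gcds

H : ℕ → ℚ
H = S inv

quot-* : ∀ v {j} → 1 ≤ j → quot (v ℕ.* j) j ≡ v
quot-* v {suc j} _ = m*n/n≡m v (suc j)

-- The sets { j v : gcd v K = 1 }, for j dividing K, are disjoint and have density φ K / (j K).
φ-harmonic : ∀ {K t} → 1 ≤ K → (∀ {j} → 1 ≤ j → j ≤ t → j ∣ K) → ι (φ K) * H t Q.≤ ι K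
-- The set belonging to `j` has period `j * K`; all these periods divide `K * K`, so counting up to
-- there is exact.
φ-harmonic {K} {t} 1≤K div = *-cancelˡ-ι 1≤K (subst₂ Q._≤_ total (trans (S-const 1ℚ (K ℕ.* K)) (trans (QP.*-identityʳ _) (ι-* K K)))
  (S-mono (K ℕ.* K) λ n _ _ → S-ind-unique (d n) t (unique n)))
  where
  P : ℕ → ℕ → Set
  P n j = j ∣ n × gcd (quot n j) K ≡ 1
  d : ∀ n j → Dec (P n j)
  d n j = j ∣? n ×-dec coprime? K (quot n j)
  divides-other : ∀ {n i j} → 1 ≤ i → i ≤ t → 1 ≤ j → P n i → P n j → i ∣ j
  -- `i` divides `n = v * j` and, being a divisor of `K`, is coprime to `v`.
  divides-other {n} {i} {j} 1≤i i≤t 1≤j (i∣n , _) (divides v refl , copj) =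
    coprime-divisor (gcd≡1⇒coprime (trans (gcd-comm i v) (gcd≡1-∣ {v} {v} {K} {i} ∣-refl (div 1≤i i≤t) (subst (λ x → gcd x K ≡ 1) (quot-* v 1≤j) copj)))) i∣n
  unique : ∀ n i j → 1 ≤ i → i ≤ t → 1 ≤ j → j ≤ t → P n i → P n j → i ≡ j
  unique n i j 1≤i i≤t 1≤j j≤t pi pj = ∣-antisym (divides-other 1≤i i≤t 1≤j pi pj) (divides-other 1≤j j≤t 1≤i pj pi)
  column : ∀ j → 1 ≤ j → j ≤ t → S (λ n → ind (d n j)) (K ℕ.* K) ≡ ι K * ι (φ K) * inv j
  column j 1≤j j≤t with div 1≤j j≤t
  ... | divides c eq = begin
    S (λ n → ind (d n j)) (K ℕ.* K)                                     ≡⟨ S-cong (K ℕ.* K) (λ n _ _ → ind-× (j ∣? n) (coprime? K (quot n j))) ⟩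
    S (λ n → ind (j ∣? n) * ind (coprime? K (quot n j))) (K ℕ.* K)      ≡⟨ cong (S (λ n → ind (j ∣? n) * ind (coprime? K (quot n j)))) K*K≡ ⟩
    S (λ n → ind (j ∣? n) * ind (coprime? K (quot n j))) (c ℕ.* K ℕ.* j) ≡⟨ S-multiples (c ℕ.* K) (λ n → ind (coprime? K (quot n j))) 1≤j ⟩
    S (λ v → ind (coprime? K (quot (v ℕ.* j) j))) (c ℕ.* K)             ≡⟨ S-cong (c ℕ.* K) (λ v _ _ → cong (λ x → ind (coprime? K x)) (quot-* v 1≤j)) ⟩
    S (λ v → ind (coprime? K v)) (c ℕ.* K)                              ≡⟨ count-coprime c K ⟩
    ι c * ι (φ K)                                                       ≡⟨ cong (_* ι (φ K)) (ι-cofactor 1≤j eq) ⟩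
    ι K * inv j * ι (φ K)                                               ≡⟨ solve 3 (λ x y z → x :* y :* z := x :* z :* y) refl (ι K) (inv j) (ι (φ K)) ⟩
    ι K * ι (φ K) * inv j                                               ∎
    where
    open ≡-Reasoning
    K*K≡ : K ℕ.* K ≡ c ℕ.* K ℕ.* j
    K*K≡ = trans (cong (K ℕ.*_) eq) (trans (sym (ℕP.*-assoc K c j)) (cong (ℕ._* j) (ℕP.*-comm K c)))
  total : S (λ n → S (λ j → ind (d n j)) t) (K ℕ.* K) ≡ ι K * (ι (φ K) * H t)
  total = trans (S-swap (λ n j → ind (d n j)) (K ℕ.* K) t) (trans (S-cong t column)
    (trans (S-*ˡ (ι K * ι (φ K)) inv t) (QP.*-assoc (ι K) (ι (φ K)) (H t))))

-- The n are grouped by the value r of `gcd n K`: for n = v r and K = c r this value means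
-- `gcd v c ≡ 1`. It turns the divisor sum defining `A` into an average.
S-gcd : ∀ {f : ℕ → ℚ} {K} → 1 ≤ K → (∀ r → 0ℚ Q.≤ f r) →
  S (λ n → f (gcd n K)) K ≡ S (λ r → ind (r ∣? K) * (f r * ι (φ (quot K r)))) K
S-gcd {f} {K} 1≤K 0≤f = begin
  S (λ n → f (gcd n K)) K                              ≡⟨ S-cong K (λ n _ _ → sym (row n)) ⟩
  S (λ n → S (term n) K) K                             ≡⟨ S-swap term K K ⟩
  S (λ r → S (λ n → term n r) K) K                     ≡⟨ S-cong K column ⟩
  S (λ r → ind (r ∣? K) * (f r * ι (φ (quot K r)))) K  ∎
  where
  open ≡-Reasoning
  -- The indicator of `r ∣ n`, implied by that of `gcd n K ≡ r`, brings the column sums into the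
  -- form evaluated by `S-multiples`.
  term : ℕ → ℕ → ℚ
  term n r = ind (r ∣? K) * (f r * (ind (r ∣? n) * ind (gcd n K ℕ.≟ r)))
  0≤term : ∀ n r → 0ℚ Q.≤ term n r
  0≤term n r = 0≤* (0≤ind (r ∣? K)) (0≤* (0≤f r) (0≤* (0≤ind (r ∣? n)) (0≤ind (gcd n K ℕ.≟ r))))
  row : ∀ n → S (term n) K ≡ f (gcd n K)
  row n = trans (S-single K (gcd n K) (0≤term n) (gcd≥1ʳ n 1≤K) (∣⇒≤ {{ℕ.>-nonZero 1≤K}} (gcd[m,n]∣n n K)) other)
    (trans (cong₂ (λ x y → x * (f (gcd n K) * y)) (ind-yes (gcd n K ∣? K) (gcd[m,n]∣n n K))
      (trans (cong₂ _*_ (ind-yes (gcd n K ∣? n) (gcd[m,n]∣m n K)) (ind-yes (gcd n K ℕ.≟ gcd n K) refl)) (QP.*-identityˡ 1ℚ)))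
      (trans (QP.*-identityˡ _) (QP.*-identityʳ (f (gcd n K)))))
    where
    other : ∀ i → 1 ≤ i → i ≤ K → i ≢ gcd n K → term n i ≡ 0ℚ
    other i _ _ neq = trans (cong (λ x → ind (i ∣? K) * (f i * (ind (i ∣? n) * x))) (ind-no (gcd n K ℕ.≟ i) λ eq → neq (sym eq)))
      (trans (cong (λ x → ind (i ∣? K) * (f i * x)) (QP.*-zeroʳ (ind (i ∣? n)))) (trans (cong (ind (i ∣? K) *_) (QP.*-zeroʳ (f i))) (QP.*-zeroʳ (ind (i ∣? K)))))
  column : ∀ r → 1 ≤ r → r ≤ K → S (λ n → term n r) K ≡ ind (r ∣? K) * (f r * ι (φ (quot K r)))
  column r 1≤r r≤K = trans (S-*ˡ (ind (r ∣? K)) (λ n → f r * (ind (r ∣? n) * ind (gcd n K ℕ.≟ r))) K)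
    (ind*-cong (r ∣? K) λ r∣K → trans (S-*ˡ (f r) (λ n → ind (r ∣? n) * ind (gcd n K ℕ.≟ r)) K) (cong (f r *_) (count r∣K)))
    where
    count : r ∣ K → S (λ n → ind (r ∣? n) * ind (gcd n K ℕ.≟ r)) K ≡ ι (φ (quot K r))
    count (divides c refl) = trans (S-multiples c (λ n → ind (gcd n (c ℕ.* r) ℕ.≟ r)) 1≤r)
      (trans (S-cong c λ v _ _ → ind-cong (gcd (v ℕ.* r) (c ℕ.* r) ℕ.≟ r) (coprime? c v) (to v) (from v))
        (trans (sym (ι-φ c)) (cong (λ x → ι (φ x)) (sym (quot-* c 1≤r)))))
      where
      scaled : ∀ v → r ℕ.* gcd v c ≡ gcd (v ℕ.* r) (c ℕ.* r)
      scaled v = trans (c*gcd[m,n]≡gcd[cm,cn] r v c) (cong₂ gcd (ℕP.*-comm r v) (ℕP.*-comm r c))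
      to : ∀ v → gcd (v ℕ.* r) (c ℕ.* r) ≡ r → gcd v c ≡ 1
      to v eq = ℕP.*-cancelˡ-≡ (gcd v c) 1 r {{ℕ.>-nonZero 1≤r}} (trans (scaled v) (trans eq (sym (ℕP.*-identityʳ r))))
      from : ∀ v → gcd v c ≡ 1 → gcd (v ℕ.* r) (c ℕ.* r) ≡ r
      from v eq = trans (sym (scaled v)) (trans (cong (r ℕ.*_) eq) (ℕP.*-identityʳ r))

-- The density of primitive elements

inv-* : ∀ {m n} → 1 ≤ m → 1 ≤ n → inv (m ℕ.* n) ≡ inv m * inv n
inv-* {m} {n} 1≤m 1≤n = begin
  inv (m ℕ.* n)                                          ≡⟨ sym (QP.*-identityʳ (inv (m ℕ.* n))) ⟩
  inv (m ℕ.* n) * 1ℚ                                     ≡⟨ cong (inv (m ℕ.* n) *_) (sym (trans (cong₂ _*_ (ι*inv 1≤m) (ι*inv 1≤n)) (QP.*-identityˡ 1ℚ))) ⟩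
  inv (m ℕ.* n) * (ι m * inv m * (ι n * inv n))          ≡⟨ solve 5 (λ x m i n j → x :* (m :* i :* (n :* j)) := m :* n :* x :* (i :* j)) refl (inv (m ℕ.* n)) (ι m) (inv m) (ι n) (inv n) ⟩
  ι m * ι n * inv (m ℕ.* n) * (inv m * inv n)            ≡⟨ cong (λ x → x * inv (m ℕ.* n) * (inv m * inv n)) (sym (ι-* m n)) ⟩
  ι (m ℕ.* n) * inv (m ℕ.* n) * (inv m * inv n)          ≡⟨ cong (_* (inv m * inv n)) (ι*inv (ℕP.*-mono-≤ 1≤m 1≤n)) ⟩
  1ℚ * (inv m * inv n)                                   ≡⟨ QP.*-identityˡ (inv m * inv n) ⟩
  inv m * inv n                                          ∎
  where open ≡-Reasoning

ι-suc : ∀ n → ι (suc n) ≡ ι n + 1ℚ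
ι-suc n = trans (cong ι (ℕP.+-comm 1 n)) (trans (ι-+ n 1) (cong (ι n +_) ι-1))

-- Counting prime factors; dyadic bounds for harmonic numbers

PrimeFactor : ℕ → ℕ → Set
PrimeFactor m ℓ = Prime ℓ × ℓ ∣ m

primeFactor? : ∀ m ℓ → Dec (PrimeFactor m ℓ)
primeFactor? m ℓ = prime? ℓ ×-dec ℓ ∣? m

-- P is the product of the c prime factors of m that are at most X.
prime-factor-product : ∀ m X → Σ ℕ λ c → Σ ℕ λ P →
  S (λ ℓ → ind (primeFactor? m ℓ)) X ≡ ι c × P ∣ m × 2 ^ c ≤ P × (∀ {p} → Prime p → p ∣ P → p ≤ X)
prime-factor-product m zero = 0 , 1 , sym ι-0 , 1∣ m , ℕP.≤-refl ,
  λ pp p∣1 → ⊥-elim (ℕP.<⇒≱ (prime≥2 pp) (∣⇒≤ p∣1))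
prime-factor-product m (suc X) with prime-factor-product m X | primeFactor? m (suc X)
... | c , P , eq , P∣m , 2^c≤P , bound | no ¬pf = c , P , trans (cong₂ _+_ eq (ind-no (primeFactor? m (suc X)) ¬pf)) (QP.+-identityʳ (ι c)) , P∣m , 2^c≤P , λ pp p∣P → ℕP.m≤n⇒m≤1+n (bound pp p∣P)
... | c , P , eq , divides b refl , 2^c≤P , bound | yes pf@(pℓ , ℓ∣m) =
  suc c , suc X ℕ.* P , trans (cong₂ _+_ eq (ind-yes (primeFactor? (b ℕ.* P) (suc X)) pf)) (sym (ι-suc c)) , *-monoˡ-∣ P (ℓ∣b (euclidsLemma b P pℓ ℓ∣m))
    , ℕP.*-mono-≤ (prime≥2 pℓ) 2^c≤P , λ {p} pp p∣ℓP → bound′ pp (euclidsLemma (suc X) P pp p∣ℓP)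
  where
  -- The prime factors of `P` are at most `X`, so the prime `suc X` divides the cofactor `b`.
  ℓ∣b : suc X ∣ b ⊎ suc X ∣ P → suc X ∣ b
  ℓ∣b (inj₁ h) = h
  ℓ∣b (inj₂ h) = ⊥-elim (ℕP.<⇒≱ (ℕP.n<1+n X) (bound pℓ h))
  bound′ : ∀ {p} → Prime p → p ∣ suc X ⊎ p ∣ P → p ≤ suc X
  bound′ pp (inj₁ h) = ∣⇒≤ h
  bound′ pp (inj₂ h) = ℕP.m≤n⇒m≤1+n (bound pp h)

-- A product of c distinct prime factors of `m` is at least 2^c and divides `m`.
count-prime-factors : ∀ {m} B X → 1 ≤ m → m ℕ.< 2 ^ B → S (λ ℓ → ind (primeFactor? m ℓ)) X Q.≤ ι B
count-prime-factors {m} B X 1≤m m<2^B with prime-factor-product m X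
... | c , P , eq , P∣m , 2^c≤P , _ = subst (Q._≤ ι B) (sym eq)
  (ι-mono (ℕP.<⇒≤ (2^-cancel-< {c} {B} (ℕP.≤-<-trans (ℕP.≤-trans 2^c≤P (∣⇒≤ {{ℕ.>-nonZero 1≤m}} P∣m)) m<2^B))))

-- The added dyadic block has 2^y terms between 1/2^(y+1) and 1/2^y, so it contributes between 1/2
-- and 1.
H-double : ∀ y → H (2 ^ suc y) ≡ H (2 ^ y) + S (λ i → inv (2 ^ y ℕ.+ i)) (2 ^ y)
H-double y = trans (cong H (cong (2 ^ y ℕ.+_) (ℕP.+-identityʳ (2 ^ y)))) (S-split inv (2 ^ y) (2 ^ y))

1≤2^ : ∀ y → 1 ≤ 2 ^ y
1≤2^ y = 1≤^ (s≤s z≤n) y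

H-upper : ∀ y → H (2 ^ y) Q.≤ ι (suc y)
H-upper zero = QP.≤-trans (subst (Q._≤ 1ℚ) (sym (QP.+-identityˡ (inv 1))) (inv≤1 1)) (QP.≤-reflexive (sym ι-1))
H-upper (suc y) = subst₂ Q._≤_ (sym (H-double y)) (sym (ι-suc (suc y))) (QP.+-mono-≤ (H-upper y)
  (QP.≤-trans (S-mono (2 ^ y) λ i _ _ → inv-antimono (1≤2^ y) (ℕP.m≤m+n (2 ^ y) i))
    (QP.≤-reflexive (trans (S-const (inv (2 ^ y)) (2 ^ y)) (ι*inv (1≤2^ y))))))

H-lower : ∀ y → ι y Q.≤ ι 2 * H (2 ^ y)
H-lower zero = subst (Q._≤ ι 2 * H 1) (sym ι-0) (0≤* (0≤ι 2) (0≤S 1 0≤inv))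
H-lower (suc y) = subst₂ Q._≤_ (sym (ι-suc y)) (sym (trans (cong (ι 2 *_) (H-double y)) (QP.*-distribˡ-+ (ι 2) (H (2 ^ y)) _)))
  (QP.+-mono-≤ (H-lower y) (QP.≤-trans (QP.≤-reflexive half) (*-monoˡ (0≤ι 2)
    (S-mono (2 ^ y) λ i 1≤i i≤ → inv-antimono (ℕP.≤-trans (1≤2^ y) (ℕP.m≤m+n (2 ^ y) i))
      (ℕP.≤-trans (ℕP.+-monoʳ-≤ (2 ^ y) i≤) (ℕP.≤-reflexive (cong (2 ^ y ℕ.+_) (sym (ℕP.+-identityʳ (2 ^ y))))))))))
  where
  half : 1ℚ ≡ ι 2 * S (λ _ → inv (2 ^ suc y)) (2 ^ y)
  half = sym (trans (cong (ι 2 *_) (S-const (inv (2 ^ suc y)) (2 ^ y)))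
    (trans (sym (QP.*-assoc (ι 2) (ι (2 ^ y)) (inv (2 ^ suc y)))) (trans (cong (_* inv (2 ^ suc y)) (sym (ι-* 2 (2 ^ y)))) (ι*inv (1≤2^ (suc y))))))

ρ-def : ∀ q n → ρ q n ≡ ι (φ (q ^ n ∸ 1)) * inv (q ^ n)
ρ-def q n = frac-def (φ (q ^ n ∸ 1)) (q ^ n)

0≤ρ : ∀ q n → 0ℚ Q.≤ ρ q n
0≤ρ q n = subst (0ℚ Q.≤_) (sym (ρ-def q n)) (0≤* (0≤ι (φ (q ^ n ∸ 1))) (0≤inv (q ^ n)))

module _ {q : ℕ} (2≤q : 2 ≤ q) where

  private
    1≤q : 1 ≤ q
    1≤q = ℕP.≤-trans (s≤s z≤n) 2≤q

    1≤q^ : ∀ n → 1 ≤ q ^ n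
    1≤q^ = 1≤^ 1≤q

    1≤q^∸1 : ∀ {n} → 1 ≤ n → 1 ≤ q ^ n ∸ 1
    1≤q^∸1 {n} 1≤n = ℕP.∸-monoˡ-≤ 1 (ℕP.≤-trans 2≤q (subst (_≤ q ^ n) (ℕP.^-identityʳ q) (ℕP.^-monoʳ-≤ q {{ℕ.>-nonZero 1≤q}} 1≤n)))

  ρ≤frac : ∀ {n a b} → 1 ≤ b → φ (q ^ n ∸ 1) ℕ.* b ≤ a ℕ.* q ^ n → ρ q n Q.≤ ι a * inv b
  ρ≤frac {n} {a} {b} 1≤b h = subst (Q._≤ ι a * inv b) (sym (ρ-def q n)) (frac-≤ {a = φ (q ^ n ∸ 1)} {q ^ n} {a} (1≤q^ n) 1≤b h)

  ρ≤1 : ∀ n → ρ q n Q.≤ 1ℚ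
  ρ≤1 n = subst (ρ q n Q.≤_) (ι*inv (s≤s (z≤n {0}))) (ρ≤frac {n} {1} {1} (s≤s z≤n)
    (ℕP.≤-trans (ℕP.≤-reflexive (ℕP.*-identityʳ _)) (ℕP.≤-trans (φ≤ (q ^ n ∸ 1)) (ℕP.≤-trans (ℕP.m∸n≤m (q ^ n) 1) (ℕP.≤-reflexive (sym (ℕP.*-identityˡ (q ^ n))))))))

  inv≤ρ : ∀ {n} → 1 ≤ n → inv (q ^ n) Q.≤ ρ q n
  inv≤ρ {n} 1≤n = subst₂ Q._≤_ (QP.*-identityˡ (inv (q ^ n))) (sym (ρ-def q n))
    (*-monoʳ (0≤inv (q ^ n)) (subst (Q._≤ ι (φ (q ^ n ∸ 1))) ι-1 (ι-mono (1≤φ (1≤q^∸1 1≤n)))))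

  -- With d = q^r - 1 and m = q^n - 1 = a d, `φ-*-≤` gives φ(m) q^r ≤ a φ(d) (d + 1) = φ(d) m + a
  -- φ(d). The last term is at most m; it becomes `inv (q ^ r)`.
  ρ-upper : ∀ {r n} → r ∣ n → ρ q n Q.≤ ρ q r + inv (q ^ r)
  ρ-upper {r} {n} r∣n with ∣^∸1-mono 1≤q r∣n ∣-refl
  ... | divides a eq = subst (ρ q n Q.≤_) (trans (cong (_* inv (q ^ r)) (ι-suc (φ d)))
      (trans (solve 2 (λ f i → (f :+ con 1ℚ) :* i := f :* i :+ i) refl (ι (φ d)) (inv (q ^ r))) (cong (_+ inv (q ^ r)) (sym (ρ-def q r)))))
    (ρ≤frac {n} {suc (φ d)} (1≤q^ r) bound)
    where
    d m : ℕ
    d = q ^ r ∸ 1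
    m = q ^ n ∸ 1
    m≤ : m ≤ q ^ n
    m≤ = ℕP.m∸n≤m (q ^ n) 1
    open ℕP.≤-Reasoning
    bound : φ m ℕ.* q ^ r ≤ suc (φ d) ℕ.* q ^ n
    bound = begin
      φ m ℕ.* q ^ r                          ≤⟨ ℕP.*-monoˡ-≤ (q ^ r) (subst (λ x → φ x ≤ a ℕ.* φ d) (sym eq) (φ-*-≤ a d)) ⟩
      a ℕ.* φ d ℕ.* q ^ r                    ≡⟨ cong (a ℕ.* φ d ℕ.*_) (^≡1+ 1≤q r) ⟩
      a ℕ.* φ d ℕ.* suc d                    ≡⟨ ℕP.*-suc (a ℕ.* φ d) d ⟩
      a ℕ.* φ d ℕ.+ a ℕ.* φ d ℕ.* d          ≤⟨ ℕP.+-mono-≤ (ℕP.*-monoʳ-≤ a (φ≤ d)) (ℕP.≤-reflexive (trans (cong (ℕ._* d) (ℕP.*-comm a (φ d))) (ℕP.*-assoc (φ d) a d))) ⟩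
      a ℕ.* d ℕ.+ φ d ℕ.* (a ℕ.* d)          ≡⟨ cong (λ x → x ℕ.+ φ d ℕ.* x) (sym eq) ⟩
      m ℕ.+ φ d ℕ.* m                        ≤⟨ ℕP.+-mono-≤ m≤ (ℕP.*-monoʳ-≤ (φ d) m≤) ⟩
      suc (φ d) ℕ.* q ^ n                    ∎

  -- The free `c` serves two purposes: `c = ρ q r` yields the approximation, a constant `c` the
  -- positive lower bound. The loss is proportional to `c`.
  ρ-lower : ∀ {c r n} → 1 ≤ r → 1 ≤ n → r ∣ n → 0ℚ Q.≤ c → c Q.≤ ρ q r →
    c Q.≤ ρ q n + c * newSum (q ^ n ∸ 1) (q ^ r ∸ 1)
  ρ-lower {c} {r} {n} 1≤r 1≤n r∣n 0≤c c≤ρ with ∣^∸1-mono 1≤q r∣n ∣-refl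
  ... | divides a eq = cases (QP.≤-total R 1ℚ)
    where
    d m : ℕ
    d = q ^ r ∸ 1
    m = q ^ n ∸ 1
    R : ℚ
    R = newSum m d
    1≤a : 1 ≤ a
    1≤a = proj₁ (1≤*⇒1≤ a d (subst (1 ≤_) eq (1≤q^∸1 1≤n)))
    sieve : ι a * ι (φ d) Q.≤ ι (φ m) + ι a * ι (φ d) * R
    sieve = subst (λ x → ι a * ι (φ d) Q.≤ ι (φ x) + ι a * ι (φ d) * newSum x d) (sym eq) (φ-sieve a 1≤a (1≤q^∸1 1≤r))
    -- Since 1 + a d ≤ a (1 + d), the change of denominators is favourable and leaves no error term.
    q^n≤ : 1 ℕ.* q ^ n ≤ a ℕ.* q ^ r
    q^n≤ = begin
      1 ℕ.* q ^ n          ≡⟨ ℕP.*-identityˡ (q ^ n) ⟩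
      q ^ n                ≡⟨ ^≡1+ 1≤q n ⟩
      1 ℕ.+ m              ≡⟨ cong (1 ℕ.+_) eq ⟩
      1 ℕ.+ a ℕ.* d        ≤⟨ ℕP.+-monoˡ-≤ (a ℕ.* d) 1≤a ⟩
      a ℕ.+ a ℕ.* d        ≡⟨ sym (ℕP.*-suc a d) ⟩
      a ℕ.* suc d          ≡⟨ cong (a ℕ.*_) (sym (^≡1+ 1≤q r)) ⟩
      a ℕ.* q ^ r          ∎
      where open ℕP.≤-Reasoning
    inv≤ : inv (q ^ r) Q.≤ ι a * inv (q ^ n)
    inv≤ = subst (Q._≤ ι a * inv (q ^ n)) (trans (cong (_* inv (q ^ r)) ι-1) (QP.*-identityˡ (inv (q ^ r))))
      (frac-≤ {1} {q ^ r} {a} (1≤q^ r) (1≤q^ n) q^n≤)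
    cases : R Q.≤ 1ℚ ⊎ 1ℚ Q.≤ R → c Q.≤ ρ q n + c * R
    cases (inj₂ 1≤R) = ≤-certify (ρ q n + c * (R - 1ℚ)) (0≤+ (0≤ρ q n) (0≤* 0≤c (≤⇒0≤- 1≤R)))
      (solve 3 (λ p c r → p :+ c :* r :- c := p :+ c :* (r :- con 1ℚ)) refl (ρ q n) c R)
    -- Three slacks add up: the sieve divided by q^n, the change of denominators, and `c ≤ ρ q r`,
    -- the latter two multiplied by 1 - R, which must therefore be nonnegative.
    cases (inj₁ R≤1) = ≤-certify
      (inv (q ^ n) * (ι (φ m) + ι a * ι (φ d) * R - ι a * ι (φ d)) + ((1ℚ - R) * (ι (φ d) * (ι a * inv (q ^ n) - inv (q ^ r))) + (1ℚ - R) * (ι (φ d) * inv (q ^ r) - c)))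
      (0≤+ (0≤* (0≤inv (q ^ n)) (≤⇒0≤- sieve)) (0≤+ (0≤* (≤⇒0≤- R≤1) (0≤* (0≤ι (φ d)) (≤⇒0≤- inv≤)))
        (0≤* (≤⇒0≤- R≤1) (≤⇒0≤- (subst (c Q.≤_) (ρ-def q r) c≤ρ)))))
      (trans (cong (λ x → x + c * R - c) (ρ-def q n))
        (solve 7 (λ c R Q F a f i → F :* Q :+ c :* R :- c := Q :* (F :+ a :* f :* R :- a :* f) :+ ((con 1ℚ :- R) :* (f :* (a :* Q :- i)) :+ (con 1ℚ :- R) :* (f :* i :- c))) refl
          c R (inv (q ^ n)) (ι (φ m)) (ι a) (ι (φ d)) (inv (q ^ r))))

  -- Bounds the sum of 1/ℓ over the primes ℓ modulo which q has order k.
  weight : ℕ → ℚ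
  weight k = (ι q + H k) * inv k

  0≤weight : ∀ k → 0ℚ Q.≤ weight k
  0≤weight k = 0≤* (0≤+ (0≤ι q) (0≤S k 0≤inv)) (0≤inv k)

  -- Weaker than q having order `k` modulo `ℓ`, and exactly what `order-witness` supplies.
  OrderPrime : ℕ → ℕ → Set
  OrderPrime k ℓ = PrimeFactor (q ^ k ∸ 1) ℓ × k ∣ ℓ ∸ 1

  orderPrime? : ∀ k ℓ → Dec (OrderPrime k ℓ)
  orderPrime? k ℓ = primeFactor? (q ^ k ∸ 1) ℓ ×-dec k ∣? (ℓ ∸ 1)

  -- The primes ℓ > k² are few, since their product is below q^k; the others are of the form jk + 1 with j ≤ k.
  S-orderPrime≤weight : ∀ {k} X → 1 ≤ k → S (λ ℓ → ind (orderPrime? k ℓ) * inv ℓ) X Q.≤ weight k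
  S-orderPrime≤weight {k} X 1≤k = QP.≤-trans (S-mono X pointwise)
    (QP.≤-trans (QP.≤-reflexive (trans (S-+ large (λ ℓ → S (small ℓ) k) X) (cong₂ _+_ (S-*ʳ (inv (k ℕ.* k)) (λ ℓ → ind (primeFactor? (q ^ k ∸ 1) ℓ)) X) (S-swap small X k))))
      (QP.≤-trans (QP.+-mono-≤
        (*-monoʳ (0≤inv (k ℕ.* k)) (count-prime-factors (q ℕ.* k) X (1≤q^∸1 1≤k) (ℕP.<-≤-trans (ℕP.≤-reflexive (sym (^≡1+ 1≤q k))) (^≤2^* q k))))
        (S-mono k column)) (QP.≤-reflexive weight≡)))
    where
    -- A large prime is charged 1/k², and there are at most q k prime factors in all; a prime j k +
    -- 1 is charged 1/(j k). The totals are q/k and `H k` / k.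
    large : ℕ → ℚ
    large ℓ = ind (primeFactor? (q ^ k ∸ 1) ℓ) * inv (k ℕ.* k)
    small : ℕ → ℕ → ℚ
    small ℓ j = ind (ℓ ℕ.≟ suc (j ℕ.* k)) * inv (j ℕ.* k)
    0≤large : ∀ ℓ → 0ℚ Q.≤ large ℓ
    0≤large ℓ = 0≤* (0≤ind (primeFactor? (q ^ k ∸ 1) ℓ)) (0≤inv (k ℕ.* k))
    0≤small : ∀ ℓ j → 0ℚ Q.≤ small ℓ j
    0≤small ℓ j = 0≤* (0≤ind (ℓ ℕ.≟ suc (j ℕ.* k))) (0≤inv (j ℕ.* k))
    0≤both : ∀ ℓ → 0ℚ Q.≤ large ℓ + S (small ℓ) k
    0≤both ℓ = 0≤+ (0≤large ℓ) (0≤S k (0≤small ℓ))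
    column : ∀ j → 1 ≤ j → j ≤ k → S (λ ℓ → small ℓ j) X Q.≤ inv j * inv k
    column j 1≤j _ = subst (Q._≤ inv j * inv k) (sym (S-*ʳ (inv (j ℕ.* k)) (λ ℓ → ind (ℓ ℕ.≟ suc (j ℕ.* k))) X))
      (QP.≤-trans (*-monoʳ (0≤inv (j ℕ.* k)) (S-ind-unique (λ ℓ → ℓ ℕ.≟ suc (j ℕ.* k)) X λ _ _ _ _ _ _ e e′ → trans e (sym e′)))
        (QP.≤-reflexive (trans (QP.*-identityˡ (inv (j ℕ.* k))) (inv-* 1≤j 1≤k))))
    weight≡ : ι (q ℕ.* k) * inv (k ℕ.* k) + S (λ j → inv j * inv k) k ≡ weight k
    weight≡ = trans (cong₂ _+_ (trans (cong₂ _*_ (ι-* q k) (inv-* 1≤k 1≤k))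
        (trans (solve 3 (λ q k i → q :* k :* (i :* i) := q :* (k :* i) :* i) refl (ι q) (ι k) (inv k))
          (cong (λ x → ι q * x * inv k) (ι*inv 1≤k)))) (S-*ʳ (inv k) inv k))
      (solve 3 (λ q h i → q :* con 1ℚ :* i :+ h :* i := (q :+ h) :* i) refl (ι q) (H k) (inv k))
    pointwise : ∀ ℓ → 1 ≤ ℓ → ℓ ≤ X → ind (orderPrime? k ℓ) * inv ℓ Q.≤ large ℓ + S (small ℓ) k
    pointwise (suc i) _ _ = ind*≤ (orderPrime? k (suc i)) (0≤both (suc i)) bound
      where
      bound : OrderPrime k (suc i) → inv (suc i) Q.≤ large (suc i) + S (small (suc i)) k
      bound (pf@(pℓ , _) , divides j eq) with suc i ℕ.≤? k ℕ.* k
      ... | no ℓ≰ = subst (Q._≤ large (suc i) + S (small (suc i)) k) (QP.+-identityʳ (inv (suc i))) (QP.+-mono-≤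
        (QP.≤-trans (inv-antimono (ℕP.*-mono-≤ 1≤k 1≤k) (ℕP.<⇒≤ (ℕP.≰⇒> ℓ≰)))
          (QP.≤-reflexive (sym (trans (cong (_* inv (k ℕ.* k)) (ind-yes (primeFactor? (q ^ k ∸ 1) (suc i)) pf)) (QP.*-identityˡ (inv (k ℕ.* k)))))))
        (0≤S k (0≤small (suc i))))
      ... | yes ℓ≤ = subst (Q._≤ large (suc i) + S (small (suc i)) k) (QP.+-identityˡ (inv (suc i))) (QP.+-mono-≤ (0≤large (suc i))
        (QP.≤-trans (QP.≤-trans (inv-antimono (ℕP.*-mono-≤ 1≤j 1≤k) (ℕP.≤-trans (ℕP.≤-reflexive (sym eq)) (ℕP.n≤1+n i)))
          (QP.≤-reflexive (sym (trans (cong (_* inv (j ℕ.* k)) (ind-yes (suc i ℕ.≟ suc (j ℕ.* k)) (cong suc eq))) (QP.*-identityˡ (inv (j ℕ.* k)))))))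
          (term≤S k j (0≤small (suc i)) 1≤j j≤k)))
        where
        1≤j : 1 ≤ j
        1≤j = proj₁ (1≤*⇒1≤ j k (subst (1 ≤_) eq (ℕP.∸-monoˡ-≤ 1 (prime≥2 pℓ))))
        j≤k : j ≤ k
        j≤k = ℕP.*-cancelʳ-≤ j k k {{ℕ.>-nonZero 1≤k}} (ℕP.≤-trans (ℕP.≤-reflexive (sym eq)) (ℕP.≤-trans (ℕP.n≤1+n i) ℓ≤))

  -- Bounds the sum of 1/ℓ over the primes ℓ dividing q ^ n ∸ 1 but not q ^ gcd n (L t) ∸ 1, for n ≤ N.
  excess : ℕ → ℕ → ℕ → ℚ
  excess t N n = S (λ k → ind (k ∣? n) * (ind (t ℕ.<? k) * weight k)) N

  -- Each new prime is charged to the `k` found by `order-witness`, which exceeds `t` by the last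
  -- hypothesis; exchanging the sums collects at most `weight k` for each `k`. Summing over divisors
  -- of `n` rather than `s` makes the bound independent of `s`.
  newSum≤excess : ∀ {t N n r s} → 1 ≤ n → n ≤ N → s ∣ n → (∀ {k} → 1 ≤ k → k ∣ s → ¬ k ∣ r → t ℕ.< k) →
    newSum (q ^ s ∸ 1) (q ^ r ∸ 1) Q.≤ excess t N n
  newSum≤excess {t} {N} {n} {r} {s} 1≤n n≤N s∣n large = QP.≤-trans (S-mono X pointwise)
    (QP.≤-trans (QP.≤-reflexive (trans (S-swap term X N) (S-cong N λ k _ _ →
      trans (S-*ˡ (ind (k ∣? n)) (λ ℓ → ind (t ℕ.<? k) * (ind (orderPrime? k ℓ) * inv ℓ)) X)
        (cong (ind (k ∣? n) *_) (S-*ˡ (ind (t ℕ.<? k)) (λ ℓ → ind (orderPrime? k ℓ) * inv ℓ) X)))))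
      (S-mono N λ k 1≤k _ → *-monoˡ (0≤ind (k ∣? n)) (*-monoˡ (0≤ind (t ℕ.<? k)) (S-orderPrime≤weight X 1≤k))))
    where
    X : ℕ
    X = q ^ s ∸ 1
    1≤s : 1 ≤ s
    1≤s = ℕP.n≢0⇒n>0 λ { refl → ℕP.n>0⇒n≢0 1≤n (0∣⇒≡0 s∣n) }
    term : ℕ → ℕ → ℚ
    term ℓ k = ind (k ∣? n) * (ind (t ℕ.<? k) * (ind (orderPrime? k ℓ) * inv ℓ))
    0≤term : ∀ ℓ k → 0ℚ Q.≤ term ℓ k
    0≤term ℓ k = 0≤* (0≤ind (k ∣? n)) (0≤* (0≤ind (t ℕ.<? k)) (0≤* (0≤ind (orderPrime? k ℓ)) (0≤inv ℓ)))
    pointwise : ∀ ℓ → 1 ≤ ℓ → ℓ ≤ X → ind (new? X (q ^ r ∸ 1) ℓ) * inv ℓ Q.≤ S (term ℓ) N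
    pointwise ℓ _ _ = ind*≤ (new? X (q ^ r ∸ 1) ℓ) (0≤S N (0≤term ℓ)) λ (pℓ , ℓ∣ , ℓ∤) → witness pℓ (order-witness 1≤q 1≤s pℓ ℓ∣ ℓ∤)
      where
      witness : Prime ℓ → (Σ ℕ λ k → 1 ≤ k × k ∣ s × k ∣ ℓ ∸ 1 × ℓ ∣ q ^ k ∸ 1 × ¬ k ∣ r) → inv ℓ Q.≤ S (term ℓ) N
      witness pℓ (k , 1≤k , k∣s , k∣ℓ-1 , ℓ∣k , k∤r) = QP.≤-trans (QP.≤-reflexive (sym term≡))
        (term≤S N k (0≤term ℓ) 1≤k (ℕP.≤-trans (∣⇒≤ {{ℕ.>-nonZero 1≤n}} (∣-trans k∣s s∣n)) n≤N))
        where
        term≡ : term ℓ k ≡ inv ℓ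
        term≡ = trans (cong₂ (λ x y → x * (y * (ind (orderPrime? k ℓ) * inv ℓ))) (ind-yes (k ∣? n) (∣-trans k∣s s∣n)) (ind-yes (t ℕ.<? k) (large 1≤k k∣s k∤r)))
          (trans (cong (λ x → 1ℚ * (1ℚ * (x * inv ℓ))) (ind-yes (orderPrime? k ℓ) ((pℓ , ℓ∣k) , k∣ℓ-1)))
            (solve 1 (λ x → con 1ℚ :* (con 1ℚ :* (con 1ℚ :* x)) := x) refl (inv ℓ)))

  -- A telescoping majorant for the sum of `weight k * inv k` over k > t. The constant 2 pays for
  -- the new term 1/(k+1) of `H`, which costs 1/(k+1)² in `tail` and 1/(k+1)³ in the summand.
  tail : ℕ → ℚ
  tail t = (H t + (ι q + ι 2)) * inv t

  0≤tail : ∀ t → 0ℚ Q.≤ tail t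
  0≤tail t = 0≤* (0≤+ (0≤S t 0≤inv) (0≤+ (0≤ι q) (0≤ι 2))) (0≤inv t)

  tail-step : ∀ {k} → 1 ≤ k → weight (suc k) * inv (suc k) + tail (suc k) Q.≤ tail k
  tail-step {k} 1≤k = ≤-certify ((h + (c + ι 2)) * y * (x - y) + y * y * (1ℚ - y))
    (0≤+ (0≤* (0≤* (0≤+ (0≤S k 0≤inv) (0≤+ (0≤ι q) (0≤ι 2))) (0≤inv (suc k))) (≤⇒0≤- (inv-antimono 1≤k (ℕP.n≤1+n k))))
      (0≤* (0≤* (0≤inv (suc k)) (0≤inv (suc k))) (≤⇒0≤- (inv≤1 (suc k)))))
    (begin
      (h + (c + ι 2)) * x - ((c + (h + y)) * y * y + (h + y + (c + ι 2)) * y)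
        ≡⟨ solve 5 (λ h c t x y → (h :+ (c :+ t)) :* x :- ((c :+ (h :+ y)) :* y :* y :+ (h :+ y :+ (c :+ t)) :* y)
             := (h :+ (c :+ t)) :* (x :- y) :- (c :+ (h :+ y)) :* y :* y :- y :* y) refl h c (ι 2) x y ⟩
      (h + (c + ι 2)) * (x - y) - (c + (h + y)) * y * y - y * y
        ≡⟨ cong (λ z → (h + (c + ι 2)) * z - (c + (h + y)) * y * y - y * y) x-y≡ ⟩
      (h + (c + ι 2)) * (x * y) - (c + (h + y)) * y * y - y * y
        ≡⟨ cong (λ z → (h + (c + z)) * (x * y) - (c + (h + y)) * y * y - y * y) ι-2 ⟩
      (h + (c + (1ℚ + 1ℚ))) * (x * y) - (c + (h + y)) * y * y - y * y
        ≡⟨ solve 4 (λ h c x y → (h :+ (c :+ (con 1ℚ :+ con 1ℚ))) :* (x :* y) :- (c :+ (h :+ y)) :* y :* y :- y :* y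
             := (h :+ (c :+ (con 1ℚ :+ con 1ℚ))) :* y :* (x :- y) :+ y :* y :* (con 1ℚ :- y)) refl h c x y ⟩
      (h + (c + (1ℚ + 1ℚ))) * y * (x - y) + y * y * (1ℚ - y)
        ≡⟨ cong (λ z → (h + (c + z)) * y * (x - y) + y * y * (1ℚ - y)) (sym ι-2) ⟩
      (h + (c + ι 2)) * y * (x - y) + y * y * (1ℚ - y) ∎)
    where
    open ≡-Reasoning
    h c x y : ℚ
    h = H k
    c = ι q
    x = inv k
    y = inv (suc k)
    ι-2 : ι 2 ≡ 1ℚ + 1ℚ
    ι-2 = trans (ι-suc 1) (cong (_+ 1ℚ) ι-1)
    x-y≡ : x - y ≡ x * y
    x-y≡ = begin
      x - y                                  ≡⟨ cong₂ _-_ (sym (QP.*-identityʳ x)) (sym (QP.*-identityˡ y)) ⟩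
      x * 1ℚ - 1ℚ * y                        ≡⟨ cong₂ (λ a b → x * a - b * y) (sym (trans (cong (_* y) (sym (ι-suc k))) (ι*inv (s≤s z≤n)))) (sym (ι*inv 1≤k)) ⟩
      x * ((ι k + 1ℚ) * y) - ι k * x * y     ≡⟨ solve 3 (λ x y k → x :* ((k :+ con 1ℚ) :* y) :- k :* x :* y := x :* y) refl x y (ι k) ⟩
      x * y                                  ∎

  S-weight≤tail : ∀ {t} N → 1 ≤ t → S (λ k → ind (t ℕ.<? k) * (weight k * inv k)) N Q.≤ tail t
  -- Lengthening the sum to `t + N` lets the telescoping start at `t`, whether or not N exceeds `t`.
  S-weight≤tail {t} N 1≤t = QP.≤-trans (S-extend 0≤g (ℕP.m≤n+m N t))
    (≤-certify (tail t - (S g (t ℕ.+ N) + tail (t ℕ.+ N)) + tail (t ℕ.+ N)) (0≤+ (≤⇒0≤- (telescope N)) (0≤tail (t ℕ.+ N)))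
      (solve 3 (λ a b c → a :- b := a :- (b :+ c) :+ c) refl (tail t) (S g (t ℕ.+ N)) (tail (t ℕ.+ N))))
    where
    g : ℕ → ℚ
    g k = ind (t ℕ.<? k) * (weight k * inv k)
    0≤weight*inv : ∀ k → 0ℚ Q.≤ weight k * inv k
    0≤weight*inv k = 0≤* (0≤weight k) (0≤inv k)
    0≤g : ∀ k → 0ℚ Q.≤ g k
    0≤g k = 0≤* (0≤ind (t ℕ.<? k)) (0≤weight*inv k)
    telescope : ∀ i → S g (t ℕ.+ i) + tail (t ℕ.+ i) Q.≤ tail t
    telescope zero = subst (λ x → S g x + tail x Q.≤ tail t) (sym (ℕP.+-identityʳ t))
      (QP.≤-reflexive (trans (cong (_+ tail t) (S-≡0 t λ k _ k≤t → trans (cong (_* (weight k * inv k)) (ind-no (t ℕ.<? k) (ℕP.≤⇒≯ k≤t))) (QP.*-zeroˡ (weight k * inv k)))) (QP.+-identityˡ (tail t))))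
    telescope (suc i) = subst (λ x → S g x + tail x Q.≤ tail t) (sym (ℕP.+-suc t i))
      (≤-certify (tail t - (S g k + tail k) + ((tail k - (weight (suc k) * inv (suc k) + tail (suc k))) + (weight (suc k) * inv (suc k) - g (suc k))))
        (0≤+ (≤⇒0≤- (telescope i)) (0≤+ (≤⇒0≤- (tail-step (ℕP.≤-trans 1≤t (ℕP.m≤m+n t i)))) (≤⇒0≤- (ind*≤ (t ℕ.<? suc k) (0≤weight*inv (suc k)) λ _ → QP.≤-refl))))
        (solve 6 (λ a s b w b′ g → a :- (s :+ g :+ b′) := a :- (s :+ b) :+ ((b :- (w :+ b′)) :+ (w :- g))) refl
          (tail t) (S g k) (tail k) (weight (suc k) * inv (suc k)) (tail (suc k)) (g (suc k))))
      where
      k : ℕ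
      k = t ℕ.+ i

  S-excess : ∀ {t} N → 1 ≤ t → S (excess t N) N Q.≤ ι N * tail t
  S-excess {t} N 1≤t = QP.≤-trans (QP.≤-reflexive (S-swap (λ n k → ind (k ∣? n) * (ind (t ℕ.<? k) * weight k)) N N))
    (QP.≤-trans (S-mono N column) (QP.≤-trans (QP.≤-reflexive (S-*ˡ (ι N) (λ k → ind (t ℕ.<? k) * (weight k * inv k)) N))
      (*-monoˡ (0≤ι N) (S-weight≤tail N 1≤t))))
    where
    column : ∀ k → 1 ≤ k → k ≤ N → S (λ n → ind (k ∣? n) * (ind (t ℕ.<? k) * weight k)) N Q.≤ ι N * (ind (t ℕ.<? k) * (weight k * inv k))
    column k 1≤k _ = subst₂ Q._≤_ (sym (S-*ʳ (ind (t ℕ.<? k) * weight k) (λ n → ind (k ∣? n)) N))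
      (solve 4 (λ n i t w → n :* i :* (t :* w) := n :* (t :* (w :* i))) refl (ι N) (inv k) (ind (t ℕ.<? k)) (weight k))
      (*-monoʳ (0≤* (0≤ind (t ℕ.<? k)) (0≤weight k)) (S-ind∣≤ N 1≤k))

-- Averages

inv*ι* : ∀ {n} x → 1 ≤ n → inv n * (ι n * x) ≡ x
inv*ι* {n} x 1≤n = trans (sym (QP.*-assoc (inv n) (ι n) x))
  (trans (cong (_* x) (trans (QP.*-comm (inv n) (ι n)) (ι*inv 1≤n))) (QP.*-identityˡ x))

ι*inv* : ∀ {n} x → 1 ≤ n → ι n * (inv n * x) ≡ x
ι*inv* {n} x 1≤n = trans (solve 3 (λ k i x → k :* (i :* x) := i :* (k :* x)) refl (ι n) (inv n) x) (inv*ι* x 1≤n)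

S-periodic-∣ : ∀ {f K N} → 1 ≤ K → K ∣ N → (∀ i → f (K ℕ.+ i) ≡ f i) → S f N ≡ ι N * (inv K * S f K)
S-periodic-∣ {f} {K} 1≤K (divides a refl) per = trans (S-periodic a per) (begin
  ι a * S f K                        ≡⟨ cong (ι a *_) (sym (ι*inv* (S f K) 1≤K)) ⟩
  ι a * (ι K * (inv K * S f K))      ≡⟨ sym (QP.*-assoc (ι a) (ι K) (inv K * S f K)) ⟩
  ι a * ι K * (inv K * S f K)        ≡⟨ cong (_* (inv K * S f K)) (sym (ι-* a K)) ⟩
  ι (a ℕ.* K) * (inv K * S f K)      ∎)
  where open ≡-Reasoning

A-mean : ∀ q t → A q t ≡ inv (L t) * S (λ n → ρ q (gcd n (L t))) (L t)
A-mean q t = cong₂ _*_ (frac1 (L t)) (begin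
  sumℚ (map term (divisors (L t)))                                          ≡⟨ sumℚ-filter (λ r → r ∣? L t) term (range1 (L t)) ⟩
  sumℚ (map (λ r → ind (r ∣? L t) * term r) (range1 (L t)))                 ≡⟨ sumℚ-range1 (λ r → ind (r ∣? L t) * term r) (L t) ⟩
  S (λ r → ind (r ∣? L t) * term r) (L t)
    ≡⟨ S-cong (L t) (λ r _ _ → cong (λ x → ind (r ∣? L t) * (ρ q r * x)) (frac/1 (φ (quot (L t) r)))) ⟩
  S (λ r → ind (r ∣? L t) * (ρ q r * ι (φ (quot (L t) r)))) (L t)           ≡⟨ sym (S-gcd {ρ q} (1≤L t) (0≤ρ q)) ⟩
  S (λ n → ρ q (gcd n (L t))) (L t)                                         ∎)
  where
  open ≡-Reasoning
  term : ℕ → ℚ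
  term r = ρ q r * frac (φ (quot (L t) r)) 1

ι*A : ∀ q t → ι (L t) * A q t ≡ S (λ n → ρ q (gcd n (L t))) (L t)
ι*A q t = trans (cong (ι (L t) *_) (A-mean q t)) (ι*inv* (S (λ n → ρ q (gcd n (L t))) (L t)) (1≤L t))

ι*M : ∀ q {N} → 1 ≤ N → ι N * M q N ≡ S (ρ q) N
ι*M q {N} 1≤N = trans (cong (ι N *_) (cong₂ _*_ (frac1 N) (sumℚ-range1 (ρ q) N))) (ι*inv* (S (ρ q) N) 1≤N)

H-unbounded : ∀ a → ι a Q.≤ H (2 ^ (2 ℕ.* a))
H-unbounded a = *-cancelˡ-ι {2} (s≤s z≤n) (subst (Q._≤ ι 2 * H (2 ^ (2 ℕ.* a))) (ι-* 2 a) (H-lower (2 ℕ.* a)))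

φ-L-small : ∀ {a t} → ι a Q.≤ H t → ι a * ι (φ (L t)) Q.≤ ι (L t)
φ-L-small {a} {t} a≤H = QP.≤-trans (*-monoʳ (0≤ι (φ (L t))) a≤H)
  (subst (Q._≤ ι (L t)) (QP.*-comm (ι (φ (L t))) (H t)) (φ-harmonic {L t} {t} (1≤L t) ≤⇒∣L))

module _ {q : ℕ} (2≤q : 2 ≤ q) where

  private
    1≤q : 1 ≤ q
    1≤q = ℕP.≤-trans (s≤s z≤n) 2≤q

    1≤q^ : ∀ n → 1 ≤ q ^ n
    1≤q^ = 1≤^ 1≤q

    gcdL : ℕ → ℕ → ℕ
    gcdL t n = gcd n (L t)

  -- The summand `inv (q ^ N)` is a reserve for the induction: as q ≥ 2, the next term and the next
  -- reserve together fit into it.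
  geometric : ∀ N → S (λ r → inv (q ^ r)) N + inv (q ^ N) Q.≤ 1ℚ
  geometric zero = subst (Q._≤ 1ℚ) (sym (QP.+-identityˡ (inv 1))) (inv≤1 1)
  geometric (suc N) = ≤-certify (1ℚ - (s + inv (q ^ N)) + (inv (q ^ N) - ι 2 * y))
    (0≤+ (≤⇒0≤- (geometric N)) (≤⇒0≤- halving))
    (trans (solve 3 (λ s x y → con 1ℚ :- (s :+ y :+ y) := con 1ℚ :- (s :+ x) :+ (x :- (con 1ℚ :+ con 1ℚ) :* y)) refl s (inv (q ^ N)) y)
      (cong (λ z → 1ℚ - (s + inv (q ^ N)) + (inv (q ^ N) - z * y)) (sym (trans (ι-suc 1) (cong (_+ 1ℚ) ι-1)))))
    where
    s y : ℚ
    s = S (λ r → inv (q ^ r)) N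
    y = inv (q ^ suc N)
    halving : ι 2 * y Q.≤ inv (q ^ N)
    halving = subst (ι 2 * y Q.≤_) (trans (cong (_* inv (q ^ N)) ι-1) (QP.*-identityˡ (inv (q ^ N))))
      (frac-≤ {2} {q ^ suc N} {1} (1≤q^ (suc N)) (1≤q^ N) (ℕP.≤-trans (ℕP.*-monoˡ-≤ (q ^ N) 2≤q) (ℕP.≤-reflexive (sym (ℕP.*-identityˡ (q ^ suc N))))))

  -- The gap between ρ q r and φ (q ^ r ∸ 1) / (q ^ r ∸ 1) is at most q ^ - r; averaged over r = gcd n (L t) it
  -- is small only because the harmonic series diverges, so that few n have a small gcd with L t.
  gcdMean : ℕ → ℚ
  gcdMean t = inv (L t) * S (λ n → inv (q ^ gcdL t n)) (L t)

  -- Grouped by r = gcd n K, the mean is a sum of q^(-r) φ(K/r) / K. Each φ(K/r) is at most φ(K),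
  -- and the powers q^(-r) add up to at most 1.
  gcdMean≤ : ∀ {a t} → 1 ≤ a → ι a Q.≤ H t → gcdMean t Q.≤ inv a
  gcdMean≤ {a} {t} 1≤a a≤H = subst (gcdMean t Q.≤_) (QP.*-identityˡ (inv a)) (≤-*inv 1≤a (QP.≤-trans (*-monoˡ (0≤ι a) step₁) step₂))
    where
    K : ℕ
    K = L t
    row : ∀ r → 1 ≤ r → r ≤ K → ind (r ∣? K) * (inv (q ^ r) * ι (φ (quot K r))) Q.≤ inv (q ^ r) * ι (φ K)
    row r 1≤r _ = ind*≤ (r ∣? K) (0≤* (0≤inv (q ^ r)) (0≤ι (φ K))) λ r∣K → *-monoˡ (0≤inv (q ^ r)) (ι-mono (φ-mono-∣ (1≤L t) (quot∣ r∣K)))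
      where
      quot∣ : r ∣ K → quot K r ∣ K
      quot∣ (divides c eq) = subst (λ x → quot x r ∣ x) (sym eq) (subst (_∣ c ℕ.* r) (sym (quot-* c 1≤r)) (m∣m*n r))
    step₁ : gcdMean t Q.≤ inv K * ι (φ K)
    step₁ = *-monoˡ (0≤inv K) (QP.≤-trans (QP.≤-reflexive (S-gcd {λ r → inv (q ^ r)} (1≤L t) (λ r → 0≤inv (q ^ r))))
      (QP.≤-trans (S-mono K row) (QP.≤-trans (QP.≤-reflexive (S-*ʳ (ι (φ K)) (λ r → inv (q ^ r)) K))
        (subst (S (λ r → inv (q ^ r)) K * ι (φ K) Q.≤_) (QP.*-identityˡ (ι (φ K))) (*-monoʳ {ι (φ K)} {S (λ r → inv (q ^ r)) K} {1ℚ} (0≤ι (φ K))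
          (≤-certify (1ℚ - (S (λ r → inv (q ^ r)) K + inv (q ^ K)) + inv (q ^ K)) (0≤+ (≤⇒0≤- (geometric K)) (0≤inv (q ^ K)))
            (solve 2 (λ s x → con 1ℚ :- s := con 1ℚ :- (s :+ x) :+ x) refl (S (λ r → inv (q ^ r)) K) (inv (q ^ K)))))))))
    step₂ : ι a * (inv K * ι (φ K)) Q.≤ 1ℚ
    step₂ = subst₂ Q._≤_ (solve 3 (λ i a f → i :* (a :* f) := a :* (i :* f)) refl (inv K) (ι a) (ι (φ K)))
      (trans (QP.*-comm (inv K) (ι K)) (ι*inv (1≤L t))) (*-monoˡ (0≤inv K) (φ-L-small {a} {t} a≤H))

  -- `s n` will be `gcd n (L u)` with u ≥ t, or `n` itself: one argument compares `A q t` both with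
  -- later terms of the sequence and with `M q N`.
  module _ {t : ℕ} (N : ℕ) (1≤t : 1 ≤ t) (s : ℕ → ℕ) (between : ∀ n → gcdL t n ∣ s n × s n ∣ n) where

    private
      1≤s : ∀ {n} → 1 ≤ n → 1 ≤ s n
      1≤s {n} 1≤n = ℕP.n≢0⇒n>0 λ s≡0 → ℕP.n>0⇒n≢0 1≤n (0∣⇒≡0 (subst (_∣ n) s≡0 (proj₂ (between n))))

      newSum≤ : ∀ {n} → 1 ≤ n → n ≤ N → newSum (q ^ s n ∸ 1) (q ^ gcdL t n ∸ 1) Q.≤ excess 2≤q t N n
      newSum≤ {n} 1≤n n≤N = newSum≤excess 2≤q 1≤n n≤N (proj₂ (between n)) λ {k} 1≤k k∣s k∤g →
        -- A divisor `k ≤ t` of n also divides `L t`, hence the gcd.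
        ℕP.≰⇒> λ k≤t → k∤g (gcd-greatest (∣-trans k∣s (proj₂ (between n))) (≤⇒∣L 1≤k k≤t))

    S-ρ-upper : S (λ n → ρ q (s n)) N Q.≤ S (λ n → ρ q (gcdL t n)) N + S (λ n → inv (q ^ gcdL t n)) N
    S-ρ-upper = subst (S (λ n → ρ q (s n)) N Q.≤_) (S-+ (λ n → ρ q (gcdL t n)) (λ n → inv (q ^ gcdL t n)) N)
      (S-mono N λ n _ _ → ρ-upper 2≤q (proj₁ (between n)))

    S-ρ-lower : S (λ n → ρ q (gcdL t n)) N Q.≤ S (λ n → ρ q (s n)) N + ι N * tail 2≤q t
    S-ρ-lower = QP.≤-trans (S-mono N pointwise) (QP.≤-trans (QP.≤-reflexive (S-+ (λ n → ρ q (s n)) (excess 2≤q t N) N))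
      (QP.+-monoʳ-≤ (S (λ n → ρ q (s n)) N) (S-excess 2≤q N 1≤t)))
      where
      pointwise : ∀ n → 1 ≤ n → n ≤ N → ρ q (gcdL t n) Q.≤ ρ q (s n) + excess 2≤q t N n
      pointwise n 1≤n n≤N = QP.≤-trans (ρ-lower 2≤q (gcd≥1ʳ n (1≤L t)) (1≤s 1≤n) (proj₁ (between n)) (0≤ρ q (gcdL t n)) QP.≤-refl)
        (QP.+-monoʳ-≤ (ρ q (s n)) (QP.≤-trans (*-monoʳ (0≤newSum (q ^ s n ∸ 1) (q ^ gcdL t n ∸ 1)) (ρ≤1 2≤q (gcdL t n)))
          (subst (Q._≤ excess 2≤q t N n) (sym (QP.*-identityˡ (newSum (q ^ s n ∸ 1) (q ^ gcdL t n ∸ 1)))) (newSum≤ 1≤n n≤N))))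

    -- Unlike in `S-ρ-lower`, the error carries the factor `c`, so the estimate remains useful
    -- however small `c` is.
    S-ρ-positive : ∀ {c} → 0ℚ Q.≤ c → (∀ n → c Q.≤ ρ q (gcdL t n)) → ι N * c Q.≤ S (λ n → ρ q (s n)) N + c * (ι N * tail 2≤q t)
    S-ρ-positive {c} 0≤c c≤ρ = subst (Q._≤ S (λ n → ρ q (s n)) N + c * (ι N * tail 2≤q t)) (S-const c N)
      (QP.≤-trans (S-mono N pointwise) (QP.≤-trans (QP.≤-reflexive (trans (S-+ (λ n → ρ q (s n)) (λ n → c * excess 2≤q t N n) N)
        (cong (S (λ n → ρ q (s n)) N +_) (S-*ˡ c (excess 2≤q t N) N))))
        (QP.+-monoʳ-≤ (S (λ n → ρ q (s n)) N) (*-monoˡ 0≤c (S-excess 2≤q N 1≤t)))))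
      where
      pointwise : ∀ n → 1 ≤ n → n ≤ N → c Q.≤ ρ q (s n) + c * excess 2≤q t N n
      pointwise n 1≤n n≤N = QP.≤-trans (ρ-lower 2≤q (gcd≥1ʳ n (1≤L t)) (1≤s 1≤n) (proj₁ (between n)) 0≤c (c≤ρ n))
        (QP.+-monoʳ-≤ (ρ q (s n)) (*-monoˡ 0≤c (newSum≤ 1≤n n≤N)))

  private
    gcdL-periodic : ∀ t (f : ℕ → ℚ) i → f (gcdL t (L t ℕ.+ i)) ≡ f (gcdL t i)
    gcdL-periodic t f i = cong f (gcd-periodic (L t) i)

    gcdL-between : ∀ {t s} → t ≤ s → ∀ n → gcdL t n ∣ gcdL s n × gcdL s n ∣ n
    gcdL-between {t} {s} t≤s n = gcd-greatest (gcd[m,n]∣m n (L t)) (∣-trans (gcd[m,n]∣n n (L t)) (L-∣ t≤s)) , gcd[m,n]∣m n (L s)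

  S-gcdL-ρ : ∀ t {N} → L t ∣ N → S (λ n → ρ q (gcdL t n)) N ≡ ι N * A q t
  S-gcdL-ρ t {N} L∣N = trans (S-periodic-∣ (1≤L t) L∣N (gcdL-periodic t (ρ q))) (cong (ι N *_) (sym (A-mean q t)))

  A-upper : ∀ {t s} → 1 ≤ t → t ≤ s → A q s Q.≤ A q t + gcdMean t
  A-upper {t} {s} 1≤t t≤s = *-cancelˡ-ι (1≤L s) (subst₂ Q._≤_ (sym (ι*A q s))
    (trans (cong₂ _+_ (S-gcdL-ρ t (L-∣ t≤s)) (S-periodic-∣ (1≤L t) (L-∣ t≤s) (gcdL-periodic t (λ r → inv (q ^ r)))))
      (sym (QP.*-distribˡ-+ (ι (L s)) (A q t) (gcdMean t))))
    (S-ρ-upper (L s) 1≤t (gcdL s) (gcdL-between t≤s)))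

  A-lower : ∀ {t s} → 1 ≤ t → t ≤ s → A q t Q.≤ A q s + tail 2≤q t
  A-lower {t} {s} 1≤t t≤s = *-cancelˡ-ι (1≤L s) (subst₂ Q._≤_ (S-gcdL-ρ t (L-∣ t≤s))
    (trans (cong (_+ ι (L s) * tail 2≤q t) (sym (ι*A q s))) (sym (QP.*-distribˡ-+ (ι (L s)) (A q s) (tail 2≤q t))))
    (S-ρ-lower (L s) 1≤t (gcdL s) (gcdL-between t≤s)))

  -- `inv (q ^ L t)` lies below ρ at every divisor of `L t` and does not depend on `s`; the sieve
  -- takes away at most half of it.
  A-positive : ∀ {t s} → 1 ≤ t → t ≤ s → tail 2≤q t Q.≤ inv 2 → inv (q ^ L t) * inv 2 Q.≤ A q s
  A-positive {t} {s} 1≤t t≤s tail≤½ = ≤-certify (A q s + c * tail 2≤q t - c + c * (inv 2 - tail 2≤q t))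
    (0≤+ (≤⇒0≤- (*-cancelˡ-ι (1≤L s) (subst (ι (L s) * c Q.≤_)
        (trans (cong (_+ c * (ι (L s) * tail 2≤q t)) (sym (ι*A q s)))
          (solve 4 (λ k a c τ → k :* a :+ c :* (k :* τ) := k :* (a :+ c :* τ)) refl (ι (L s)) (A q s) c (tail 2≤q t)))
        (S-ρ-positive (L s) 1≤t (gcdL s) (gcdL-between t≤s) (0≤inv (q ^ L t)) c≤ρ))))
      (0≤* (0≤inv (q ^ L t)) (≤⇒0≤- tail≤½)))
    (trans (cong (λ x → A q s - x) (trans (solve 2 (λ c h → c :* h := c :* ((con 1ℚ :+ con 1ℚ) :* h) :- c :* h) refl c (inv 2))
        (cong (λ x → c * x - c * inv 2) (trans (cong (_* inv 2) (sym (trans (ι-suc 1) (cong (_+ 1ℚ) ι-1)))) (ι*inv {2} (s≤s z≤n))))))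
      (solve 4 (λ a c τ h → a :- (c :* con 1ℚ :- c :* h) := a :+ c :* τ :- c :+ c :* (h :- τ)) refl (A q s) c (tail 2≤q t) (inv 2)))
    where
    c : ℚ
    c = inv (q ^ L t)
    c≤ρ : ∀ n → c Q.≤ ρ q (gcdL t n)
    c≤ρ n = QP.≤-trans (inv-antimono (1≤q^ (gcdL t n)) (ℕP.^-monoʳ-≤ q {{ℕ.>-nonZero 1≤q}} (∣⇒≤ {{ℕ.>-nonZero (1≤L t)}} (gcd[m,n]∣n n (L t)))))
      (inv≤ρ 2≤q (gcd≥1ʳ n (1≤L t)))

  -- The incomplete last period costs at most `L t`, which is at most N/a. `M-upper` pays this
  -- twice, for the averages of ρ and of q^(-gcd).
  module _ {a t N : ℕ} (1≤t : 1 ≤ t) (1≤a : 1 ≤ a) (1≤N : 1 ≤ N) (aL≤N : a ℕ.* L t ≤ N) where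

    private
      between : ∀ n → gcdL t n ∣ n × n ∣ n
      between n = gcd[m,n]∣m n (L t) , ∣-refl

      L≤ : ι (L t) Q.≤ ι N * inv a
      L≤ = ≤-*inv 1≤a (subst (Q._≤ ι N) (ι-* a (L t)) (ι-mono aL≤N))

      averageρ : (S (λ n → ρ q (gcdL t n)) N Q.≤ ι N * (inv (L t) * S (λ n → ρ q (gcdL t n)) (L t)) + ι (L t))
        × (ι N * (inv (L t) * S (λ n → ρ q (gcdL t n)) (L t)) Q.≤ S (λ n → ρ q (gcdL t n)) N + ι (L t))
      averageρ = S-periodic-average N (1≤L t) (gcdL-periodic t (ρ q)) (λ n → 0≤ρ q (gcdL t n)) (λ n → ρ≤1 2≤q (gcdL t n))

      average-inv : S (λ n → inv (q ^ gcdL t n)) N Q.≤ ι N * gcdMean t + ι (L t)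
      average-inv = proj₁ (S-periodic-average N (1≤L t) (gcdL-periodic t (λ r → inv (q ^ r))) (λ n → 0≤inv (q ^ gcdL t n)) (λ n → inv≤1 (q ^ gcdL t n)))

    M-upper : M q N Q.≤ A q t + (gcdMean t + (inv a + inv a))
    M-upper = *-cancelˡ-ι 1≤N (subst₂ Q._≤_ (sym (ι*M q 1≤N))
      (trans (cong (λ x → ι N * x + ι N * inv a + (ι N * gcdMean t + ι N * inv a)) (sym (A-mean q t)))
        (solve 4 (λ k x g i → k :* x :+ k :* i :+ (k :* g :+ k :* i) := k :* (x :+ (g :+ (i :+ i)))) refl (ι N) (A q t) (gcdMean t) (inv a)))
      (QP.≤-trans (S-ρ-upper N 1≤t (λ n → n) between)
        (QP.+-mono-≤ (QP.≤-trans (proj₁ averageρ) (QP.+-monoʳ-≤ (ι N * (inv (L t) * S (λ n → ρ q (gcdL t n)) (L t))) L≤))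
          (QP.≤-trans average-inv (QP.+-monoʳ-≤ (ι N * gcdMean t) L≤)))))

    M-lower : A q t Q.≤ M q N + (tail 2≤q t + inv a)
    M-lower = *-cancelˡ-ι 1≤N (subst₂ Q._≤_ (cong (ι N *_) (sym (A-mean q t)))
      (trans (cong (λ x → x + ι N * tail 2≤q t + ι N * inv a) (sym (ι*M q 1≤N)))
        (solve 4 (λ k x g i → k :* x :+ k :* g :+ k :* i := k :* (x :+ (g :+ i))) refl (ι N) (M q N) (tail 2≤q t) (inv a)))
      (QP.≤-trans (proj₂ averageρ) (QP.+-mono-≤ (S-ρ-lower N 1≤t (λ n → n) between) L≤)))

  opaque
    -- For `t = 2 ^ (2 * x)` the dyadic bounds give x ≤ `H t` ≤ 2x + 1, so `gcdMean` is small for x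
    -- ≥ a and `tail` for large x. Opaque, because only the inequalities matter and `t` is far too
    -- large to compute.
    ∃-small-errors : ∀ {a} → 1 ≤ a → Σ ℕ λ t → 1 ≤ t × tail 2≤q t Q.≤ inv a × gcdMean t Q.≤ inv a
    ∃-small-errors {a} 1≤a = t , 1≤2^ (2 ℕ.* x) , tail≤ , gcdMean≤ {a} {t} 1≤a (QP.≤-trans (ι-mono a≤x) (H-unbounded x))
      where
      x t : ℕ
      -- Chosen so that a (2x + 1 + q + 2) ≤ a (q + 5)(x + 1) = x (x + 1) ≤ 4^x = t.
      x = a ℕ.* (q ℕ.+ 5)
      t = 2 ^ (2 ℕ.* x)
      a≤x : a ≤ x
      a≤x = ℕP.m≤m*n a (q ℕ.+ 5) {{ℕ.>-nonZero (ℕP.≤-trans (s≤s z≤n) (ℕP.m≤n+m 5 q))}}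
      growth : (suc (2 ℕ.* x) ℕ.+ (q ℕ.+ 2)) ℕ.* a ≤ 1 ℕ.* t
      growth = begin
        (suc (2 ℕ.* x) ℕ.+ (q ℕ.+ 2)) ℕ.* a     ≤⟨ ℕP.*-monoˡ-≤ a (ℕP.+-mono-≤ (s≤s (ℕP.*-monoˡ-≤ x (ℕP.≤-trans (s≤s (s≤s z≤n)) (ℕP.m≤n+m 5 q)))) ℕP.≤-refl) ⟩
        (suc ((q ℕ.+ 5) ℕ.* x) ℕ.+ (q ℕ.+ 2)) ℕ.* a  ≤⟨ ℕP.*-monoˡ-≤ a (ℕP.≤-trans (ℕP.≤-reflexive (trans (sym (ℕP.+-suc ((q ℕ.+ 5) ℕ.* x) (q ℕ.+ 2))) (ℕP.+-comm ((q ℕ.+ 5) ℕ.* x) (suc (q ℕ.+ 2))))) (ℕP.+-monoˡ-≤ ((q ℕ.+ 5) ℕ.* x) (ℕP.≤-trans (ℕP.≤-reflexive (sym (ℕP.+-suc q 2))) (ℕP.+-monoʳ-≤ q (s≤s (s≤s (s≤s z≤n))))))) ⟩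
        (q ℕ.+ 5 ℕ.+ (q ℕ.+ 5) ℕ.* x) ℕ.* a     ≡⟨ cong (ℕ._* a) (sym (ℕP.*-suc (q ℕ.+ 5) x)) ⟩
        (q ℕ.+ 5) ℕ.* suc x ℕ.* a               ≡⟨ trans (ℕP.*-comm ((q ℕ.+ 5) ℕ.* suc x) a) (sym (ℕP.*-assoc a (q ℕ.+ 5) (suc x))) ⟩
        x ℕ.* suc x                             ≤⟨ ℕP.*-mono-≤ (ℕP.<⇒≤ (n<2^n x)) (n<2^n x) ⟩
        2 ^ x ℕ.* 2 ^ x                         ≡⟨ sym (ℕP.^-distribˡ-+-* 2 x x) ⟩
        2 ^ (x ℕ.+ x)                           ≡⟨ cong (λ y → 2 ^ (x ℕ.+ y)) (sym (ℕP.+-identityʳ x)) ⟩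
        t                                       ≡⟨ sym (ℕP.*-identityˡ t) ⟩
        1 ℕ.* t                                 ∎
        where open ℕP.≤-Reasoning
      tail≤ : tail 2≤q t Q.≤ inv a
      tail≤ = QP.≤-trans (*-monoʳ (0≤inv t) (QP.+-monoˡ-≤ (ι q + ι 2) (H-upper (2 ℕ.* x))))
        (subst₂ Q._≤_ (cong (_* inv t) (trans (ι-+ (suc (2 ℕ.* x)) (q ℕ.+ 2)) (cong (ι (suc (2 ℕ.* x)) +_) (ι-+ q 2))))
          (trans (cong (_* inv a) ι-1) (QP.*-identityˡ (inv a)))
          (frac-≤ {suc (2 ℕ.* x) ℕ.+ (q ℕ.+ 2)} {t} {1} (1≤2^ (2 ℕ.* x)) 1≤a growth))

four-inv : ∀ {a} → 1 ≤ a → inv (4 ℕ.* a) + (inv (4 ℕ.* a) + (inv (4 ℕ.* a) + inv (4 ℕ.* a))) ≡ inv a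
four-inv {a} 1≤a = begin
  i + (i + (i + i))                        ≡⟨ solve 1 (λ i → i :+ (i :+ (i :+ i)) := (con 1ℚ :+ con 1ℚ :+ con 1ℚ :+ con 1ℚ) :* i) refl i ⟩
  (1ℚ + 1ℚ + 1ℚ + 1ℚ) * i                  ≡⟨ cong (_* i) (sym (trans (ι-suc 3) (cong (_+ 1ℚ) (trans (ι-suc 2) (cong (_+ 1ℚ) (trans (ι-suc 1) (cong (_+ 1ℚ) ι-1))))))) ⟩
  ι 4 * i                                  ≡⟨ cong (ι 4 *_) (inv-* {4} (s≤s z≤n) 1≤a) ⟩
  ι 4 * (inv 4 * inv a)                    ≡⟨ ι*inv* {4} (inv a) (s≤s z≤n) ⟩
  inv a                                    ∎
  where
  open ≡-Reasoning
  i : ℚ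
  i = inv (4 ℕ.* a)

-- Convergence, positivity and small limits

module _ {q : ℕ} (2≤q : 2 ≤ q) where

  private
    -- Four shares of ε, as consumed by the bound of `M q N` by `A q N`: one from `A q N` to
    -- `A q t`, one for `gcdMean`, two for incomplete periods.
    module Approximation (ε : ℚ) (0<ε : 0ℚ < ε) where
      a₀ a t : ℕ
      a₀ = proj₁ (archimedean 0<ε)
      a = 4 ℕ.* a₀
      1≤a₀ : 1 ≤ a₀
      1≤a₀ = proj₁ (proj₂ (archimedean 0<ε))
      1≤a : 1 ≤ a
      1≤a = ℕP.≤-trans 1≤a₀ (ℕP.m≤n*m a₀ 4)
      η : ℚ
      η = inv a
      t = proj₁ (∃-small-errors 2≤q 1≤a)
      1≤t : 1 ≤ t
      1≤t = proj₁ (proj₂ (∃-small-errors 2≤q 1≤a))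
      tail≤η : tail 2≤q t Q.≤ η
      tail≤η = proj₁ (proj₂ (proj₂ (∃-small-errors 2≤q 1≤a)))
      gcdMean≤η : gcdMean 2≤q t Q.≤ η
      gcdMean≤η = proj₂ (proj₂ (proj₂ (∃-small-errors 2≤q 1≤a)))
      4η<ε : η + (η + (η + η)) < ε
      4η<ε = subst (_< ε) (sym (four-inv 1≤a₀)) (proj₂ (proj₂ (archimedean 0<ε)))
      0≤η : 0ℚ Q.≤ η
      0≤η = 0≤inv a
      upper : ∀ {s} → t ≤ s → A q s Q.≤ A q t + η
      upper t≤s = QP.≤-trans (A-upper 2≤q 1≤t t≤s) (QP.+-monoʳ-≤ (A q t) gcdMean≤η)
      lower : ∀ {s} → t ≤ s → A q t Q.≤ A q s + η
      lower {s} t≤s = QP.≤-trans (A-lower 2≤q 1≤t t≤s) (QP.+-monoʳ-≤ (A q s) tail≤η)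

  A-cauchy : Cauchy (A q)
  A-cauchy ε 0<ε = t , λ m n t≤m t≤n → QP.≤-<-trans (∣-∣≤ (close m n t≤m t≤n) (close n m t≤n t≤m)) 4η<ε
    where
    open Approximation ε 0<ε
    close : ∀ m n → t ≤ m → t ≤ n → A q m Q.≤ A q n + (η + (η + (η + η)))
    close m n t≤m t≤n = ≤-certify (A q t + η - A q m + (A q n + η - A q t) + (η + η))
      (0≤+ (0≤+ (≤⇒0≤- (upper t≤m)) (≤⇒0≤- (lower t≤n))) (0≤+ 0≤η 0≤η))
      (solve 4 (λ m n t η → n :+ (η :+ (η :+ (η :+ η))) :- m := t :+ η :- m :+ (n :+ η :- t) :+ (η :+ η)) refl (A q m) (A q n) (A q t) η)

  A-M-tendsToZero : TendsToZero (λ N → A q N - M q N)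
  A-M-tendsToZero ε 0<ε = suc (t ℕ.+ a ℕ.* L t) , λ N N₀≤N → QP.≤-<-trans (∣-∣≤
      (A≤ N (t≤ N₀≤N) (1≤N N₀≤N) (aL≤ N₀≤N)) (M≤ N (t≤ N₀≤N) (1≤N N₀≤N) (aL≤ N₀≤N))) 4η<ε
    where
    open Approximation ε 0<ε
    module _ {N : ℕ} (N₀≤N : suc (t ℕ.+ a ℕ.* L t) ≤ N) where
      1≤N : 1 ≤ N
      1≤N = ℕP.≤-trans (s≤s z≤n) N₀≤N
      t≤ : t ≤ N
      t≤ = ℕP.≤-trans (ℕP.m≤m+n t (a ℕ.* L t)) (ℕP.<⇒≤ N₀≤N)
      aL≤ : a ℕ.* L t ≤ N
      aL≤ = ℕP.≤-trans (ℕP.m≤n+m (a ℕ.* L t) t) (ℕP.<⇒≤ N₀≤N)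
    A≤ : ∀ N → t ≤ N → 1 ≤ N → a ℕ.* L t ≤ N → A q N Q.≤ M q N + (η + (η + (η + η)))
    A≤ N t≤N 1≤N aL≤N = ≤-certify (A q t + η - A q N + (M q N + (tail 2≤q t + η) - A q t) + (η - tail 2≤q t + η))
      (0≤+ (0≤+ (≤⇒0≤- (upper t≤N)) (≤⇒0≤- (M-lower 2≤q {a} {t} {N} 1≤t 1≤a 1≤N aL≤N))) (0≤+ (≤⇒0≤- tail≤η) 0≤η))
      (solve 5 (λ N M t η τ → M :+ (η :+ (η :+ (η :+ η))) :- N := t :+ η :- N :+ (M :+ (τ :+ η) :- t) :+ (η :- τ :+ η)) refl (A q N) (M q N) (A q t) η (tail 2≤q t))
    M≤ : ∀ N → t ≤ N → 1 ≤ N → a ℕ.* L t ≤ N → M q N Q.≤ A q N + (η + (η + (η + η)))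
    M≤ N t≤N 1≤N aL≤N = ≤-certify (A q N + η - A q t + (A q t + (gcdMean 2≤q t + (η + η)) - M q N) + (η - gcdMean 2≤q t))
      (0≤+ (0≤+ (≤⇒0≤- (lower t≤N)) (≤⇒0≤- (M-upper 2≤q {a} {t} {N} 1≤t 1≤a 1≤N aL≤N))) (≤⇒0≤- gcdMean≤η))
      (solve 5 (λ N M t η τ → N :+ (η :+ (η :+ (η :+ η))) :- M := N :+ η :- t :+ (t :+ (τ :+ (η :+ η)) :- M) :+ (η :- τ)) refl (A q N) (M q N) (A q t) η (gcdMean 2≤q t))

  A-bounded-below : Σ ℚ (λ c → 0ℚ < c × Σ ℕ (λ T → ∀ t → T ≤ t → c Q.≤ A q t))
  A-bounded-below = inv (q ^ L t) * inv 2 , 0<c , t , λ s t≤s → A-positive 2≤q 1≤t t≤s tail≤½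
    where
    t : ℕ
    t = proj₁ (∃-small-errors 2≤q {2} (s≤s z≤n))
    1≤t : 1 ≤ t
    1≤t = proj₁ (proj₂ (∃-small-errors 2≤q {2} (s≤s z≤n)))
    tail≤½ : tail 2≤q t Q.≤ inv 2
    tail≤½ = proj₁ (proj₂ (proj₂ (∃-small-errors 2≤q {2} (s≤s z≤n))))
    1≤q^L : 1 ≤ q ^ L t
    1≤q^L = 1≤^ (ℕP.≤-trans (s≤s z≤n) 2≤q) (L t)
    0<c : 0ℚ < inv (q ^ L t) * inv 2
    0<c = subst (0ℚ <_) (inv-* 1≤q^L (s≤s z≤n)) (0<inv (ℕP.*-mono-≤ 1≤q^L (s≤s (z≤n {1}))))

  -- `K` divides q - 1 and so every q^n - 1, which bounds every ρ_q(n) by φ(K)/K, uniformly in n and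
  -- `t`.
  A≤inv : ∀ {K a} t → 1 ≤ a → 1 ≤ K → K ∣ q ∸ 1 → ι a * ι (φ K) Q.≤ ι K → A q t Q.≤ inv a
  A≤inv {K} {a} t 1≤a 1≤K K∣q-1 small = *-cancelˡ-ι (1≤L t) (subst₂ Q._≤_ (sym (ι*A q t)) (S-const (inv a) (L t))
    (S-mono (L t) λ n _ _ → ρ≤inv (gcd n (L t)) (gcd≥1ʳ n (1≤L t))))
    where
    1≤q : 1 ≤ q
    1≤q = ℕP.≤-trans (s≤s z≤n) 2≤q
    aφ≤K : a ℕ.* φ K ≤ K
    aφ≤K = ι-cancel-≤ (subst (Q._≤ ι K) (sym (ι-* a (φ K))) small)
    ρ≤inv : ∀ n → 1 ≤ n → ρ q n Q.≤ inv a
    ρ≤inv n 1≤n with ∣^∸1-mono {q} 1≤q {K} {1} {n} (1∣ n) (subst (λ x → K ∣ x ∸ 1) (sym (ℕP.^-identityʳ q)) K∣q-1)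
    ... | divides c eq = subst (ρ q n Q.≤_) (trans (cong (_* inv a) ι-1) (QP.*-identityˡ (inv a))) (ρ≤frac 2≤q {n} {1} 1≤a (begin
      φ (q ^ n ∸ 1) ℕ.* a      ≤⟨ ℕP.*-monoˡ-≤ a (subst (λ x → φ x ≤ c ℕ.* φ K) (sym eq) (φ-*-≤ c K)) ⟩
      c ℕ.* φ K ℕ.* a          ≡⟨ trans (ℕP.*-assoc c (φ K) a) (cong (c ℕ.*_) (ℕP.*-comm (φ K) a)) ⟩
      c ℕ.* (a ℕ.* φ K)        ≤⟨ ℕP.*-monoʳ-≤ c aφ≤K ⟩
      c ℕ.* K                  ≡⟨ sym eq ⟩
      q ^ n ∸ 1                ≤⟨ ℕP.m∸n≤m (q ^ n) 1 ⟩
      q ^ n                    ≡⟨ sym (ℕP.*-identityˡ (q ^ n)) ⟩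
      1 ℕ.* q ^ n              ∎))
      where open ℕP.≤-Reasoning

∃-small-φ : ∀ a → Σ ℕ λ K → 1 ≤ K × ι a * ι (φ K) Q.≤ ι K
∃-small-φ a = L t , 1≤L t , φ-L-small {a} {t} (H-unbounded a)
  where
  t : ℕ
  t = 2 ^ (2 ℕ.* a)

A-small : ∀ {ε a K Q₀} → 1 ≤ a → inv a < ε → 1 ≤ K → ι a * ι (φ K) Q.≤ ι K →
  (Σ ℕ λ q → IsPrimePower q × Q₀ ≤ q × K ∣ q ∸ 1) →
  Σ ℕ (λ q → IsPrimePower q × Q₀ ≤ q × Σ ℕ (λ T → ∀ t → T ≤ t → A q t < ε))
A-small {ε} {a} {K} 1≤a inv<ε 1≤K small (q , pp , Q₀≤q , K∣q-1) = q , pp , Q₀≤q , 0 , λ t _ →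
  QP.≤-<-trans {A q t} {inv a} {ε} (A≤inv {q} (prime-power≥2 pp) {K} {a} t 1≤a 1≤K K∣q-1 small) inv<ε

-- The limit is a real number given by a Cauchy sequence of rationals. Its positivity is an eventual
-- rational lower bound, and the averages `M q` share it because the difference tends to zero. As
-- the limits are positive, liminf 0 means that arbitrarily large q have `A q t` eventually below
-- any given ε.
theorem4p1 : ((q : ℕ) → IsPrimePower q →
    Cauchy (A q)
    × TendsToZero (λ N → A q N - M q N)
    × Σ ℚ (λ c → 0ℚ < c × Σ ℕ (λ T → ∀ t → T ≤ t → c Q.≤ A q t)))
    × (∀ (ε : ℚ) → 0ℚ < ε → ∀ (Q₀ : ℕ) →
    Σ ℕ (λ q → IsPrimePower q × Q₀ ≤ q
    × Σ ℕ (λ T → ∀ t → T ≤ t → A q t < ε)))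
theorem4p1 = (λ q pp → A-cauchy {q} (prime-power≥2 pp) , A-M-tendsToZero {q} (prime-power≥2 pp) , A-bounded-below {q} (prime-power≥2 pp)) , liminf
  where
  liminf : ∀ (ε : ℚ) → 0ℚ < ε → ∀ (Q₀ : ℕ) →
    Σ ℕ (λ q → IsPrimePower q × Q₀ ≤ q × Σ ℕ (λ T → ∀ t → T ≤ t → A q t < ε))
  liminf ε 0<ε Q₀ =
    let a , 1≤a , inv<ε = archimedean 0<ε
        K , 1≤K , small = ∃-small-φ a
    in A-small 1≤a inv<ε 1≤K small (∃-prime-power Q₀ 1≤K)
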